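{- For integers $n\ge 3$, let $f_q(n)$ be the total number of occurrences of the pattern $q$ in all permutations of $S_n(123,132,213)$. Then, as formal power series in $x$, $$\sum_{n\geq 3}f_{231}(n)x^n=\sum_{n\geq 3}f_{312}(n)x^n=\frac{x^3(1+2x)}{(1-x-x^2)^3},$$ $$\sum_{n\geq 3}f_{321}(n)x^n=\frac{x^3(1+6x+12x^2+8x^3)}{(1-x-x^2)^4}.$$
   Context: $S_n$ is the set of permutations of $\{1,\dots,n\}$ written in one-line notation $\sigma=\sigma_1\sigma_2\cdots\sigma_n$. For $q\in S_k$, an occurrence of the pattern $q$ in $\sigma\in S_n$ is a choice of indices $i_1<i_2<\cdots<i_k$ in $\{1,\dots,n\}$ such that for all $1\le j,l\le k$, $q_j<q_l$ if and only if $\sigma_{i_j}<\sigma_{i_l}$. Let $f_q(\sigma)$ be the number of occurrences of $q$ in $\sigma$; $\sigma$ avoids $q$ if $f_q(\sigma)=0$. $S_n(123,132,213)$ is the set of permutations in $S_n$ avoiding all of $123$, $132$ and $213$, and $f_q(n)=\sum_{\sigma\in S_n(123,132,213)}f_q(\sigma)$. -}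

module Defs where

open import Algebra.Bundles.Raw using (RawRing)
import Algebra.Definitions.RawSemiring as RawSemiringDefinitions
open import Data.Bool.Base using (if_then_else_)
open import Data.Fin.Base using (Fin; toℕ; _<_)
open import Data.Fin.Patterns using (0F; 1F; 2F)
open import Data.Fin.Properties using (_≟_; _<?_; all?; any?)
open import Data.Integer.Base as ℤ using (ℤ; 0ℤ; 1ℤ)
import Data.Integer.Properties as ℤₚ
open import Data.Integer.Tactic.RingSolver using (solve-∀)
open import Data.List.Base as List using (List; allFin; cartesianProductWith; filter; length)
open import Data.Nat.Base as ℕ using (ℕ; zero; suc; _∸_)
import Data.Nat.Properties as ℕₚ
open import Data.Nat.ListAction using (sum)
open import Data.Product.Base using (_×_; _,_)
open import Data.Vec.Base using (Vec; []; _∷_; lookup)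
open import Data.Vec.Relation.Unary.Linked using (Linked; linked?)
open import Function.Bundles using (_⇔_; mk⇔; Equivalence)
open import Function.Definitions using (Injective; Surjective; Bijective)
open import Function.Consequences.Propositional using (strictlySurjective⇒surjective; surjective⇒strictlySurjective)
open import Level using (0ℓ)
open import Relation.Binary.PropositionalEquality using (_≡_; refl; cong; _≗_; module ≡-Reasoning)
open import Relation.Nullary.Decidable using (Dec; does; map′; _×-dec_; _→-dec_)
open import Relation.Unary using (Decidable)

open import Algebra.Properties.Semiring.Sum ℤₚ.+-*-semiring using (sum-syntax)

-- One-line notation, with both positions and values numbered from 0:
-- the letter i of {1,…,n} is the element i − 1 of Fin n.

Word : ℕ → ℕ → Set
Word n k = Vec (Fin n) k

words : ∀ n k → List (Word n k)
words n zero    = [] List.∷ List.[]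
words n (suc k) = cartesianProductWith _∷_ (allFin n) (words n k)

IsPermutation : ∀ {n} → Word n n → Set
IsPermutation σ = Bijective _≡_ _≡_ (lookup σ)

injective? : ∀ {m n} (f : Fin m → Fin n) → Dec (Injective _≡_ _≡_ f)
injective? f = map′ (λ inj {x} {y} → inj x y) (λ inj x y → inj {x} {y})
  (all? λ x → all? λ y → (f x ≟ f y) →-dec (x ≟ y))

surjective? : ∀ {m n} (f : Fin m → Fin n) → Dec (Surjective _≡_ _≡_ f)
surjective? f = map′ strictlySurjective⇒surjective surjective⇒strictlySurjective
  (all? λ y → any? λ x → f x ≟ y)

isPermutation? : ∀ {n} → Decidable (IsPermutation {n})
isPermutation? σ = injective? (lookup σ) ×-dec surjective? (lookup σ)

permutations : ∀ n → List (Word n n)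
permutations n = filter isPermutation? (words n n)

-- ι lists the chosen positions i₁ < i₂ < ⋯ < iₖ.

IsOccurrence : ∀ {k n} → Word k k → Word n n → Word n k → Set
IsOccurrence q σ ι =
  Linked _<_ ι ×
  (∀ j l → lookup q j < lookup q l ⇔ lookup σ (lookup ι j) < lookup σ (lookup ι l))

_⇔-dec_ : ∀ {A B : Set} → Dec A → Dec B → Dec (A ⇔ B)
a? ⇔-dec b? = map′ (λ (f , g) → mk⇔ f g) (λ e → Equivalence.to e , Equivalence.from e)
  ((a? →-dec b?) ×-dec (b? →-dec a?))

isOccurrence? : ∀ {k n} (q : Word k k) (σ : Word n n) → Decidable (IsOccurrence q σ)
isOccurrence? q σ ι = linked? _<?_ ι ×-dec
  (all? λ j → all? λ l →
    (lookup q j <? lookup q l) ⇔-dec (lookup σ (lookup ι j) <? lookup σ (lookup ι l)))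

occurrences : ∀ {k n} → Word k k → Word n n → ℕ
occurrences {k} {n} q σ = length (filter (isOccurrence? q σ) (words n k))

Avoids : ∀ {k n} → Word k k → Word n n → Set
Avoids q σ = occurrences q σ ≡ 0

avoids? : ∀ {k n} (q : Word k k) → Decidable (Avoids {k} {n} q)
avoids? q σ = occurrences q σ ℕₚ.≟ 0

p123 p132 p213 p231 p312 p321 : Word 3 3
p123 = 0F ∷ 1F ∷ 2F ∷ []
p132 = 0F ∷ 2F ∷ 1F ∷ []
p213 = 1F ∷ 0F ∷ 2F ∷ []
p231 = 1F ∷ 2F ∷ 0F ∷ []
p312 = 2F ∷ 0F ∷ 1F ∷ []
p321 = 2F ∷ 1F ∷ 0F ∷ []

S[123,132,213] : ∀ n → List (Word n n)
S[123,132,213] n =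
  filter (λ σ → avoids? p123 σ ×-dec avoids? p132 σ ×-dec avoids? p213 σ) (permutations n)

f : ∀ {k} → Word k k → ℕ → ℕ
f q n = sum (List.map (occurrences q) (S[123,132,213] n))

-- Coefficient sequences of formal power series over ℤ.

Series : Set
Series = ℕ → ℤ

seriesRawRing : RawRing 0ℓ 0ℓ
seriesRawRing = record
  { Carrier = Series
  ; _≈_     = _≗_
  ; _+_     = λ A B n → A n ℤ.+ B n
  ; _*_     = λ A B n → ∑[ i < suc n ] (A (toℕ i) ℤ.* B (n ∸ toℕ i))
  ; -_      = λ A n → ℤ.- A n
  ; 0#      = λ _ → 0ℤ
  ; 1#      = λ { zero → 1ℤ ; (suc _) → 0ℤ }
  }

open RawRing seriesRawRing using (_≈_; _+_; _*_; -_; 0#; 1#; rawSemiring) public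
open RawSemiringDefinitions rawSemiring using (_^_) public

infixl 6 _-_
_-_ : Series → Series → Series
A - B = A + (- B)

infixl 7 _·_
_·_ : ℕ → Series → Series
(c · A) n = ℤ.+ c ℤ.* A n

X : Series
X 1 = 1ℤ
X _ = 0ℤ

-- Quotient by a series with constant term 1, by long division:
-- if P = P₀ + xP′ and Q = 1 + xQ′ then P / Q = P₀ + x (P′ − P₀ Q′) / Q.

infixl 7 _/_⟨_⟩
_/_⟨_⟩ : (P Q : Series) → .(Q 0 ≡ 1ℤ) → Series
(P / Q ⟨ Q₀≡1 ⟩) zero    = P 0
(P / Q ⟨ Q₀≡1 ⟩) (suc n) = ((λ m → P (suc m) ℤ.- P 0 ℤ.* Q (suc m)) / Q ⟨ Q₀≡1 ⟩) n

/-* : ∀ P Q (Q₀≡1 : Q 0 ≡ 1ℤ) → P / Q ⟨ Q₀≡1 ⟩ * Q ≈ P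
/-* P Q Q₀≡1 zero = begin
  P 0 ℤ.* Q 0 ℤ.+ 0ℤ ≡⟨ ℤₚ.+-identityʳ _ ⟩
  P 0 ℤ.* Q 0        ≡⟨ cong (P 0 ℤ.*_) Q₀≡1 ⟩
  P 0 ℤ.* 1ℤ         ≡⟨ ℤₚ.*-identityʳ (P 0) ⟩
  P 0                ∎
  where open ≡-Reasoning
/-* P Q Q₀≡1 (suc n) = begin
  P 0 ℤ.* Q (suc n) ℤ.+ (R / Q ⟨ Q₀≡1 ⟩ * Q) n          ≡⟨ cong (λ c → P 0 ℤ.* Q (suc n) ℤ.+ c) (/-* R Q Q₀≡1 n) ⟩
  P 0 ℤ.* Q (suc n) ℤ.+ (P (suc n) ℤ.- P 0 ℤ.* Q (suc n)) ≡⟨ cancel (P 0 ℤ.* Q (suc n)) (P (suc n)) ⟩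
  P (suc n)                                               ∎
  where
  open ≡-Reasoning
  R : Series
  R m = P (suc m) ℤ.- P 0 ℤ.* Q (suc m)
  cancel : ∀ a b → a ℤ.+ (b ℤ.- a) ≡ b
  cancel = solve-∀

-- ∑_{n ≥ m} a(n) xⁿ

gf≥ : ℕ → (ℕ → ℕ) → Series
gf≥ m a n = if does (m ℕₚ.≤? n) then ℤ.+ a n else 0ℤ

{-# OPTIONS --safe #-}
module Submission where

-- A nonempty permutation of length n avoids 123, 132 and 213 exactly when it is n τ or (n − 1) n τ
-- with τ again avoiding them.  For a pattern a p whose first letter a is its maximum, prefixing one
-- letter adds the occurrences of p in τ once, and prefixing two letters adds them twice; for a
-- pattern a b p with b > a > p only the second prefix adds anything, namely the occurrences of p
-- in τ.  With D = 1 − x − x², the totals therefore satisfy A D = (x + 2x²) B in the first case and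
-- A D = x² B in the second, where B counts p.  Starting from the empty pattern, whose series is
-- 1 / D, two steps lead to 231 and 312 and three steps to 321.

open import Algebra.Bundles using (AbelianGroup; CommutativeRing)
import Algebra.Construct.Pointwise as Pointwise
open import Data.Fin.Base as Fin using (Fin; zero; suc; toℕ; fromℕ; inject₁; punchOut)
open import Data.Fin.Patterns using (0F; 1F; 2F)
import Data.Fin.Properties as Finₚ
open import Data.Fin.Relation.Unary.Top using (view; ‵fromℕ; ‵inject₁)
open import Data.Integer.Base as ℤ using (ℤ; 0ℤ; 1ℤ)
import Data.Integer.Properties as ℤₚ
open import Data.Integer.Tactic.RingSolver using (solve-∀)
open import Data.List.Base as List using (List; filter; length)
import Data.List.Properties as Listₚ
open import Data.List.Membership.Propositional using (_∈_)
import Data.List.Membership.Propositional.Properties as ∈ₚ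
open import Data.List.Membership.Propositional.Properties.WithK using (unique∧set⇒bag)
open import Data.List.Relation.Binary.BagAndSetEquality using (∼bag⇒↭)
open import Data.List.Relation.Binary.Permutation.Propositional using (_↭_)
import Data.List.Relation.Binary.Permutation.Propositional.Properties as ↭ₚ
import Data.List.Relation.Unary.All as Listᴬ
import Data.List.Relation.Unary.All.Properties as Listᴬₚ
import Data.List.Relation.Unary.AllPairs as Listᴾ
open import Data.List.Relation.Unary.Any using (here)
open import Data.List.Relation.Unary.Unique.Propositional using (Unique)
import Data.List.Relation.Unary.Unique.Propositional.Properties as Uniqueₚ
open import Data.Nat.Base as ℕ using (ℕ; zero; suc; s<s; z<s; s<s⁻¹)
open import Data.Nat.ListAction using (sum)
open import Data.Nat.ListAction.Properties using (sum-++; sum-↭)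
import Data.Nat.Properties as ℕₚ
open import Data.Product.Base as Product using (_×_; _,_; proj₁; proj₂; ∃)
open import Data.Sum.Base using (_⊎_; inj₁; inj₂; [_,_])
open import Data.Vec.Base as Vec using (Vec; []; _∷_; lookup)
import Data.Vec.Properties as Vecₚ
open import Data.Vec.Relation.Unary.All as All using (All; []; _∷_)
import Data.Vec.Relation.Unary.All.Properties as Allₚ
open import Data.Vec.Relation.Unary.AllPairs as AllPairs using (AllPairs; []; _∷_)
import Data.Vec.Relation.Unary.AllPairs.Properties as AllPairsₚ
open import Data.Vec.Relation.Unary.Linked as Linked using (Linked; []; [-]; _∷_)
import Data.Vec.Relation.Unary.Linked.Properties as Linkedₚ
open import Function.Base using (_∘_; id)
open import Function.Bundles using (_⇔_; mk⇔; Equivalence)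
open import Function.Consequences.Propositional using (strictlySurjective⇒surjective)
open import Function.Definitions using (Injective)
open import Level using (0ℓ)
open import Relation.Binary.Definitions using (tri<; tri≈; tri>)
open import Relation.Binary.PropositionalEquality
  using (_≡_; _≢_; refl; sym; trans; cong; cong₂; subst; subst₂; module ≡-Reasoning)
open import Relation.Nullary using (¬_; yes; no; contradiction)
open import Relation.Nullary.Decidable using (_×-dec_)
open import Relation.Unary using (Pred; Decidable)
open import Defs

open import Algebra.Properties.Semiring.Sum ℤₚ.+-*-semiring using (sum-cong-≗)
open Equivalence using (to; from)

-- The ring of formal power series

-- The statement counts index words over `Fin n`, and prefixing a letter changes both `n` and the
-- type of every letter, so a recursion on permutations has no fixed ground there. Reading words
-- through `toℕ` removes this: an occurrence becomes a subword of a vector of naturals, `inject₁`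
-- disappears, and a tail of a pattern serves as a pattern without renumbering. What decides each
-- count is then that the prefixed letters exceed all letters after them, apart from the single
-- ascent inside a two-letter prefix. Series equations are kept in the multiplied form
-- `A * D ^ k ≈ P`. Division enters only at the end, through `quotient-unique`.

tail : Series → Series
tail A = A ∘ suc

*-cong : ∀ {A A′ B B′} → A ≈ A′ → B ≈ B′ → A * B ≈ A′ * B′
*-cong A≈A′ B≈B′ n = sum-cong-≗ {n = suc n} (λ i → cong₂ ℤ._*_ (A≈A′ (toℕ i)) (B≈B′ (n ℕ.∸ toℕ i)))

-- The product is a sum over `Fin`, so `(A * B) (suc n)` unfolds by computation to
-- `A 0 ℤ.* B (suc n) ℤ.+ (tail A * B) n`. The inductions behind the ring laws all run along this
-- peeling.
*-zeroˡ : ∀ A → (λ _ → 0ℤ) * A ≈ (λ _ → 0ℤ)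
*-zeroˡ A zero    = refl
*-zeroˡ A (suc n) = trans (ℤₚ.+-identityˡ _) (*-zeroˡ A n)

*-identityˡ : ∀ A → 1# * A ≈ A
*-identityˡ A zero    = trans (ℤₚ.+-identityʳ _) (ℤₚ.*-identityˡ _)
*-identityˡ A (suc n) = begin
  1ℤ ℤ.* A (suc n) ℤ.+ ((λ _ → 0ℤ) * A) n ≡⟨ cong₂ ℤ._+_ (ℤₚ.*-identityˡ (A (suc n))) (*-zeroˡ A n) ⟩
  A (suc n) ℤ.+ 0ℤ                        ≡⟨ ℤₚ.+-identityʳ _ ⟩
  A (suc n)                               ∎
  where open ≡-Reasoning

*-distribʳ-+ : ∀ C A B → (A + B) * C ≈ A * C + B * C
*-distribʳ-+ C A B zero    = lemma (A 0) (B 0) (C 0)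
  where
  lemma : ∀ a b c → (a ℤ.+ b) ℤ.* c ℤ.+ 0ℤ ≡ (a ℤ.* c ℤ.+ 0ℤ) ℤ.+ (b ℤ.* c ℤ.+ 0ℤ)
  lemma = solve-∀
*-distribʳ-+ C A B (suc n) = trans
  (cong (λ z → (A 0 ℤ.+ B 0) ℤ.* C (suc n) ℤ.+ z) (*-distribʳ-+ C (tail A) (tail B) n))
  (lemma (A 0) (B 0) (C (suc n)) ((tail A * C) n) ((tail B * C) n))
  where
  lemma : ∀ a b c x y → (a ℤ.+ b) ℤ.* c ℤ.+ (x ℤ.+ y) ≡ (a ℤ.* c ℤ.+ x) ℤ.+ (b ℤ.* c ℤ.+ y)
  lemma = solve-∀

*-scale : ∀ c A B n → ((λ m → c ℤ.* A m) * B) n ≡ c ℤ.* (A * B) n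
*-scale c A B zero    = lemma c (A 0) (B 0)
  where
  lemma : ∀ c a b → c ℤ.* a ℤ.* b ℤ.+ 0ℤ ≡ c ℤ.* (a ℤ.* b ℤ.+ 0ℤ)
  lemma = solve-∀
*-scale c A B (suc n) = trans
  (cong (λ z → c ℤ.* A 0 ℤ.* B (suc n) ℤ.+ z) (*-scale c (tail A) B n))
  (lemma c (A 0) (B (suc n)) ((tail A * B) n))
  where
  lemma : ∀ c a b x → c ℤ.* a ℤ.* b ℤ.+ c ℤ.* x ≡ c ℤ.* (a ℤ.* b ℤ.+ x)
  lemma = solve-∀

*-assoc : ∀ A B C → (A * B) * C ≈ A * (B * C)
*-assoc A B C zero    = lemma (A 0) (B 0) (C 0)
  where
  lemma : ∀ a b c → (a ℤ.* b ℤ.+ 0ℤ) ℤ.* c ℤ.+ 0ℤ ≡ a ℤ.* (b ℤ.* c ℤ.+ 0ℤ) ℤ.+ 0ℤ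
  lemma = solve-∀
*-assoc A B C (suc n) = begin
  (A * B) 0 ℤ.* C (suc n) ℤ.+ (tail (A * B) * C) n
    ≡⟨ cong (λ z → (A * B) 0 ℤ.* C (suc n) ℤ.+ z) tail-expand ⟩
  (A 0 ℤ.* B 0 ℤ.+ 0ℤ) ℤ.* C (suc n) ℤ.+ (A 0 ℤ.* (tail B * C) n ℤ.+ (tail A * (B * C)) n)
    ≡⟨ lemma (A 0) (B 0) (C (suc n)) ((tail B * C) n) _ ⟩
  A 0 ℤ.* (B 0 ℤ.* C (suc n) ℤ.+ (tail B * C) n) ℤ.+ (tail A * (B * C)) n ∎
  where
  open ≡-Reasoning
  lemma : ∀ a b c x y → (a ℤ.* b ℤ.+ 0ℤ) ℤ.* c ℤ.+ (a ℤ.* x ℤ.+ y) ≡ a ℤ.* (b ℤ.* c ℤ.+ x) ℤ.+ y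
  lemma = solve-∀
  -- By the peeling, `tail (A * B)` is definitionally `tail B` scaled by `A 0`, plus `tail A * B`.
  tail-expand : (tail (A * B) * C) n ≡ A 0 ℤ.* (tail B * C) n ℤ.+ (tail A * (B * C)) n
  tail-expand = begin
    (tail (A * B) * C) n
      ≡⟨ *-distribʳ-+ C (λ m → A 0 ℤ.* tail B m) (tail A * B) n ⟩
    ((λ m → A 0 ℤ.* tail B m) * C) n ℤ.+ ((tail A * B) * C) n
      ≡⟨ cong₂ ℤ._+_ (*-scale (A 0) (tail B) C n) (*-assoc (tail A) B C n) ⟩
    A 0 ℤ.* (tail B * C) n ℤ.+ (tail A * (B * C)) n ∎

-- The mirror peeling, at the other end of the convolution. Commutativity needs it because swapping
-- the factors turns the first summand into the last.
*-suc : ∀ A B n → (A * B) (suc n) ≡ (A * tail B) n ℤ.+ A (suc n) ℤ.* B 0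
*-suc A B zero    = lemma (A 0) (A 1) (B 0) (B 1)
  where
  lemma : ∀ a a′ b b′ → a ℤ.* b′ ℤ.+ (a′ ℤ.* b ℤ.+ 0ℤ) ≡ (a ℤ.* b′ ℤ.+ 0ℤ) ℤ.+ a′ ℤ.* b
  lemma = solve-∀
*-suc A B (suc n) = trans
  (cong (λ z → A 0 ℤ.* B (suc (suc n)) ℤ.+ z) (*-suc (tail A) B n))
  (sym (ℤₚ.+-assoc (A 0 ℤ.* B (suc (suc n))) ((tail A * tail B) n) _))

*-comm : ∀ A B → A * B ≈ B * A
*-comm A B zero    = cong (ℤ._+ 0ℤ) (ℤₚ.*-comm (A 0) (B 0))
*-comm A B (suc n) = begin
  A 0 ℤ.* B (suc n) ℤ.+ (tail A * B) n ≡⟨ cong₂ ℤ._+_ (ℤₚ.*-comm (A 0) (B (suc n))) (*-comm (tail A) B n) ⟩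
  B (suc n) ℤ.* A 0 ℤ.+ (B * tail A) n ≡⟨ ℤₚ.+-comm (B (suc n) ℤ.* A 0) _ ⟩
  (B * tail A) n ℤ.+ B (suc n) ℤ.* A 0 ≡⟨ *-suc B A n ⟨
  (B * A) (suc n)                      ∎
  where open ≡-Reasoning

seriesCommutativeRing : CommutativeRing 0ℓ 0ℓ
seriesCommutativeRing = record
  { Carrier = Series
  ; _≈_     = _≈_
  ; _+_     = _+_
  ; _*_     = _*_
  ; -_      = -_
  ; 0#      = 0#
  ; 1#      = 1#
  ; isCommutativeRing = record
    { isRing = record
      { +-isAbelianGroup = AbelianGroup.isAbelianGroup (Pointwise.abelianGroup ℕ ℤₚ.+-0-abelianGroup)
      ; *-cong     = λ {A} {A′} {B} {B′} → *-cong {A} {A′} {B} {B′}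
      ; *-assoc    = *-assoc
      ; *-identity = *-identityˡ , λ A n → trans (*-comm A 1# n) (*-identityˡ A n)
      ; distrib    = (λ C A B n → trans (*-comm C (A + B) n)
                       (trans (*-distribʳ-+ C A B n) (cong₂ ℤ._+_ (*-comm A C n) (*-comm B C n))))
                   , *-distribʳ-+
      }
    ; *-comm = *-comm
    }
  }

module R = CommutativeRing seriesCommutativeRing
open import Algebra.Properties.Ring R.ring using (x[y-z]≈xy-xz)
open import Algebra.Properties.Semiring.Mult.TCOptimised R.semiring using (1+×) renaming (_×_ to _×ₛ_)
open import Algebra.Solver.Ring.NaturalCoefficients.Default R.commutativeSemiring
  using (solve; _:=_; _:+_; _:*_; con; _:^_)
import Relation.Binary.Reasoning.Setoid R.setoid as ≈-Reasoning

-- Comparing constant terms gives `A 0 ≡ P 0`. Removing the contribution of `A 0` leaves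
-- `tail A * Q` equal to the remainder on which long division recurses, so the induction has to vary
-- `A` and `P`.
quotient-unique : ∀ A P Q (Q₀≡1 : Q 0 ≡ 1ℤ) → A * Q ≈ P → A ≈ P / Q ⟨ Q₀≡1 ⟩
quotient-unique A P Q Q₀≡1 A*Q≈P = go A P A*Q≈P
  where
  open ≡-Reasoning
  cancel : ∀ a b → b ≡ a ℤ.+ b ℤ.- a
  cancel = solve-∀
  head-≡ : ∀ A P → A * Q ≈ P → A 0 ≡ P 0
  head-≡ A P A*Q≈P = begin
    A 0                ≡⟨ ℤₚ.*-identityʳ (A 0) ⟨
    A 0 ℤ.* 1ℤ         ≡⟨ cong (A 0 ℤ.*_) Q₀≡1 ⟨
    A 0 ℤ.* Q 0        ≡⟨ ℤₚ.+-identityʳ _ ⟨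
    A 0 ℤ.* Q 0 ℤ.+ 0ℤ ≡⟨ A*Q≈P 0 ⟩
    P 0                ∎
  go : ∀ A P → A * Q ≈ P → A ≈ P / Q ⟨ Q₀≡1 ⟩
  go A P A*Q≈P zero    = head-≡ A P A*Q≈P
  go A P A*Q≈P (suc n) = go (tail A) (λ m → P (suc m) ℤ.- P 0 ℤ.* Q (suc m)) (λ m → begin
    (tail A * Q) m
      ≡⟨ cancel (A 0 ℤ.* Q (suc m)) _ ⟩
    (A * Q) (suc m) ℤ.- A 0 ℤ.* Q (suc m)
      ≡⟨ cong₂ (λ x y → x ℤ.- y ℤ.* Q (suc m)) (A*Q≈P (suc m)) (head-≡ A P A*Q≈P) ⟩
    P (suc m) ℤ.- P 0 ℤ.* Q (suc m) ∎) n

X*-suc : ∀ A n → (X * A) (suc n) ≡ A n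
X*-suc A n = begin
  0ℤ ℤ.* A (suc n) ℤ.+ (tail X * A) n ≡⟨ ℤₚ.+-identityˡ _ ⟩
  (tail X * A) n                      ≡⟨ *-cong {tail X} {1#} {A} {A} tail-X (λ _ → refl) n ⟩
  (1# * A) n                          ≡⟨ *-identityˡ A n ⟩
  A n                                 ∎
  where
  open ≡-Reasoning
  tail-X : tail X ≈ 1#
  tail-X zero    = refl
  tail-X (suc _) = refl

X²*-suc² : ∀ A n → (X ^ 2 * A) (suc (suc n)) ≡ A n
X²*-suc² A n = begin
  (X ^ 2 * A) (suc (suc n))   ≡⟨ solve 2 (λ x a → x :^ 2 :* a := x :* (x :* a)) R.refl X A (suc (suc n)) ⟩
  (X * (X * A)) (suc (suc n)) ≡⟨ X*-suc (X * A) (suc n) ⟩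
  (X * A) (suc n)             ≡⟨ X*-suc A n ⟩
  A n                         ∎
  where open ≡-Reasoning

-- The semiring solver reads a numeral as a multiple of `1#`; this translates the scalar `·` of the
-- statement into that language.
·-× : ∀ c A → c · A ≈ (c ×ₛ 1#) * A
·-× zero    A n = trans (ℤₚ.*-zeroˡ (A n)) (sym (*-zeroˡ A n))
·-× (suc c) A n = begin
  ℤ.+ suc c ℤ.* A n          ≡⟨ ℤₚ.suc-* (ℤ.+ c) (A n) ⟩
  A n ℤ.+ ℤ.+ c ℤ.* A n      ≡⟨ cong₂ ℤ._+_ (sym (*-identityˡ A n)) (·-× c A n) ⟩
  (1# * A + (c ×ₛ 1#) * A) n ≡⟨ *-distribʳ-+ A 1# (c ×ₛ 1#) n ⟨
  ((1# + c ×ₛ 1#) * A) n     ≡⟨ *-cong {suc c ×ₛ 1#} {1# + c ×ₛ 1#} {A} {A} (1+× c 1#) (λ _ → refl) n ⟨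
  ((suc c ×ₛ 1#) * A) n      ∎
  where open ≡-Reasoning

-- Fibonacci-type recurrences as equations of series

D Y : Series
D = 1# - X - X ^ 2
Y = X + (2 ×ₛ 1#) * X ^ 2

*-D : ∀ A → A * D ≈ A - X * A - X ^ 2 * A
*-D A = begin
  A * (1# - X - X ^ 2)         ≈⟨ x[y-z]≈xy-xz A (1# - X) (X ^ 2) ⟩
  A * (1# - X) - A * X ^ 2     ≈⟨ R.+-congʳ {x = - (A * X ^ 2)} (x[y-z]≈xy-xz A 1# X) ⟩
  A * 1# - A * X - A * X ^ 2   ≈⟨ (λ n → cong₂ ℤ._-_
                                     (cong₂ ℤ._-_ (R.*-identityʳ A n) (*-comm A X n))
                                     (*-comm A (X ^ 2) n)) ⟩
  A - X * A - X ^ 2 * A        ∎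
  where open ≈-Reasoning

-- The hypotheses are the coefficients of A = P + xA + x²A, read in degrees 0, 1 and at least 2.
linear-recurrence : ∀ A P → A 0 ≡ P 0 → A 1 ≡ P 1 ℤ.+ A 0 →
  (∀ n → A (suc (suc n)) ≡ P (suc (suc n)) ℤ.+ A (suc n) ℤ.+ A n) → A * D ≈ P
linear-recurrence A P e₀ e₁ e₂ n = trans (*-D A n) (pointwise n)
  where
  lemma₀ : ∀ a → a ℤ.- 0ℤ ℤ.- 0ℤ ≡ a
  lemma₀ = solve-∀
  lemma₁ : ∀ p a → p ℤ.+ a ℤ.- a ℤ.- 0ℤ ≡ p
  lemma₁ = solve-∀
  lemma₂ : ∀ p a a′ → p ℤ.+ a ℤ.+ a′ ℤ.- a ℤ.- a′ ≡ p
  lemma₂ = solve-∀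
  pointwise : A - X * A - X ^ 2 * A ≈ P
  -- A series shifted by `X` or `X ^ 2` computes to `0ℤ` below the shift; these are the zeros in
  -- `lemma₀` and `lemma₁`.
  pointwise 0             = trans (lemma₀ (A 0)) e₀
  pointwise 1             = trans (cong₂ (λ x y → x ℤ.- y ℤ.- 0ℤ) e₁ (X*-suc A 0)) (lemma₁ (P 1) (A 0))
  pointwise (suc (suc n)) = trans
    (cong₂ ℤ._-_ (cong₂ ℤ._-_ (e₂ n) (X*-suc A (suc n))) (X²*-suc² A n))
    (lemma₂ (P (suc (suc n))) (A (suc n)) (A n))

gf : (ℕ → ℕ) → Series
gf a n = ℤ.+ a n

-- Meant for the empty pattern, which occurs once in every permutation: its totals are the Fibonacci
-- numbers that count the avoiders.
gf-fibonacci : ∀ a → a 0 ≡ 1 → a 1 ≡ a 0 → (∀ n → a (suc (suc n)) ≡ a (suc n) ℕ.+ a n) →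
  gf a * D ≈ 1#
gf-fibonacci a e₀ e₁ e₂ = linear-recurrence (gf a) 1# (cong ℤ.+_ e₀) (cong ℤ.+_ e₁)
  (λ n → trans (cong ℤ.+_ (e₂ n)) (cong (ℤ._+ ℤ.+ a n) (sym (ℤₚ.+-identityˡ (ℤ.+ a (suc n))))))

gf-ascent : ∀ a b → a 0 ≡ 0 → a 1 ≡ a 0 →
  (∀ n → a (suc (suc n)) ≡ a (suc n) ℕ.+ (b n ℕ.+ a n)) → gf a * D ≈ X ^ 2 * gf b
gf-ascent a b e₀ e₁ e₂ = linear-recurrence (gf a) (X ^ 2 * gf b) (cong ℤ.+_ e₀) (cong ℤ.+_ e₁)
  (λ n → begin
    ℤ.+ a (suc (suc n))
      ≡⟨ cong ℤ.+_ (e₂ n) ⟩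
    ℤ.+ a (suc n) ℤ.+ (ℤ.+ b n ℤ.+ ℤ.+ a n)
      ≡⟨ lemma (ℤ.+ a (suc n)) (ℤ.+ b n) (ℤ.+ a n) ⟩
    ℤ.+ b n ℤ.+ ℤ.+ a (suc n) ℤ.+ ℤ.+ a n
      ≡⟨ cong (λ z → z ℤ.+ ℤ.+ a (suc n) ℤ.+ ℤ.+ a n) (X²*-suc² (gf b) n) ⟨
    (X ^ 2 * gf b) (suc (suc n)) ℤ.+ ℤ.+ a (suc n) ℤ.+ ℤ.+ a n ∎)
  where
  open ≡-Reasoning
  lemma : ∀ x y z → x ℤ.+ (y ℤ.+ z) ≡ y ℤ.+ x ℤ.+ z
  lemma = solve-∀

Y* : ∀ B → Y * B ≈ X * B + 2 · (X ^ 2 * B)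
Y* B n = trans
  (solve 2 (λ x b → (x :+ con 2 :* x :^ 2) :* b := x :* b :+ con 2 :* (x :^ 2 :* b)) R.refl X B n)
  (cong (λ z → (X * B) n ℤ.+ z) (sym (·-× 2 (X ^ 2 * B) n)))

gf-max : ∀ a b → a 0 ≡ 0 → a 1 ≡ b 0 ℕ.+ a 0 →
  (∀ n → a (suc (suc n)) ≡ (b (suc n) ℕ.+ a (suc n)) ℕ.+ (b n ℕ.+ (b n ℕ.+ a n))) →
  gf a * D ≈ Y * gf b
gf-max a b e₀ e₁ e₂ = linear-recurrence (gf a) (Y * gf b)
  (cong ℤ.+_ e₀)
  -- In degree one only the `X` part of `Y` contributes, since a two-letter prefix needs length two;
  -- the `X ^ 2` part computes to zero.
  (trans (cong ℤ.+_ e₁) (cong (ℤ._+ ℤ.+ a 0)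
    (sym (trans (Y* (gf b) 1) (trans (ℤₚ.+-identityʳ _) (X*-suc (gf b) 0))))))
  (λ n → begin
    ℤ.+ a (suc (suc n))
      ≡⟨ cong ℤ.+_ (e₂ n) ⟩
    (ℤ.+ b (suc n) ℤ.+ ℤ.+ a (suc n)) ℤ.+ (ℤ.+ b n ℤ.+ (ℤ.+ b n ℤ.+ ℤ.+ a n))
      ≡⟨ lemma (ℤ.+ b (suc n)) (ℤ.+ a (suc n)) (ℤ.+ b n) (ℤ.+ a n) ⟩
    ℤ.+ b (suc n) ℤ.+ ℤ.+ 2 ℤ.* ℤ.+ b n ℤ.+ ℤ.+ a (suc n) ℤ.+ ℤ.+ a n
      ≡⟨ cong (λ z → z ℤ.+ ℤ.+ a (suc n) ℤ.+ ℤ.+ a n) (Y*-suc² n) ⟨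
    (Y * gf b) (suc (suc n)) ℤ.+ ℤ.+ a (suc n) ℤ.+ ℤ.+ a n ∎)
  where
  open ≡-Reasoning
  lemma : ∀ x y z w → (x ℤ.+ y) ℤ.+ (z ℤ.+ (z ℤ.+ w)) ≡ x ℤ.+ ℤ.+ 2 ℤ.* z ℤ.+ y ℤ.+ w
  lemma = solve-∀
  Y*-suc² : ∀ n → (Y * gf b) (suc (suc n)) ≡ ℤ.+ b (suc n) ℤ.+ ℤ.+ 2 ℤ.* ℤ.+ b n
  Y*-suc² n = trans (Y* (gf b) (suc (suc n)))
    (cong₂ (λ x y → x ℤ.+ ℤ.+ 2 ℤ.* y) (X*-suc (gf b) (suc n)) (X²*-suc² (gf b) n))

-- Each step of the pattern recursion costs one factor `D` and contributes one numerator factor, so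
-- quotients of quotients never arise.
chain : ∀ k {A B P R} → A * D ≈ P * B → B * D ^ k ≈ R → A * D ^ suc k ≈ P * R
chain k {A} {B} {P} {R} A*D B*Dᵏ = begin
  A * (D * D ^ k) ≈⟨ R.*-assoc A D (D ^ k) ⟨
  A * D * D ^ k   ≈⟨ *-cong {A * D} {P * B} {D ^ k} {D ^ k} A*D (λ _ → refl) ⟩
  P * B * D ^ k   ≈⟨ R.*-assoc P B (D ^ k) ⟩
  P * (B * D ^ k) ≈⟨ *-cong {P} {P} {B * D ^ k} {R} (λ _ → refl) B*Dᵏ ⟩
  P * R           ∎
  where open ≈-Reasoning

1+2X : 1# + 2 · X ≈ 1# + (2 ×ₛ 1#) * X
1+2X n = cong (λ z → 1# n ℤ.+ z) (·-× 2 X n)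

[1+2X]³ : 1# + 6 · X + 12 · X ^ 2 + 8 · X ^ 3 ≈
          1# + (6 ×ₛ 1#) * X + (12 ×ₛ 1#) * X ^ 2 + (8 ×ₛ 1#) * X ^ 3
[1+2X]³ n = cong₂ ℤ._+_
  (cong₂ ℤ._+_ (cong (λ z → 1# n ℤ.+ z) (·-× 6 X n)) (·-× 12 (X ^ 2) n))
  (·-× 8 (X ^ 3) n)

-- The pattern 231 is an ascent put before a single letter, and 312 is a maximum put before an
-- ascent. The same factors `X ^ 2` and `Y` arise in opposite orders, which is why the two series
-- agree.
X²Y : X ^ 2 * (Y * 1#) ≈ X ^ 3 * (1# + 2 · X)
X²Y n = trans
  (solve 1 (λ x → x :^ 2 :* ((x :+ con 2 :* x :^ 2) :* con 1) :=
                  x :^ 3 :* (con 1 :+ con 2 :* x)) R.refl X n)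
  (sym (*-cong {X ^ 3} {X ^ 3} (λ _ → refl) 1+2X n))

YX² : Y * (X ^ 2 * 1#) ≈ X ^ 3 * (1# + 2 · X)
YX² n = trans
  (solve 1 (λ x → (x :+ con 2 :* x :^ 2) :* (x :^ 2 :* con 1) :=
                  x :^ 3 :* (con 1 :+ con 2 :* x)) R.refl X n)
  (sym (*-cong {X ^ 3} {X ^ 3} (λ _ → refl) 1+2X n))

-- The polynomial of the statement is (1 + 2x)³, and `Y` is x(1 + 2x).
Y³ : Y * (Y * (Y * 1#)) ≈ X ^ 3 * (1# + 6 · X + 12 · X ^ 2 + 8 · X ^ 3)
Y³ n = trans
  (solve 1 (λ x → let y = x :+ con 2 :* x :^ 2 in
     y :* (y :* (y :* con 1)) :=
     x :^ 3 :* (con 1 :+ con 6 :* x :+ con 12 :* x :^ 2 :+ con 8 :* x :^ 3)) R.refl X n)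
  (sym (*-cong {X ^ 3} {X ^ 3} (λ _ → refl) [1+2X]³ n))

-- Occurrences as matching subwords

count : ∀ {A : Set} {P : Pred A 0ℓ} → Decidable P → List A → ℕ
count P? xs = length (filter P? xs)

count-cong : ∀ {A : Set} {P Q : Pred A 0ℓ} (P? : Decidable P) (Q? : Decidable Q) {xs} →
  Listᴬ.All (λ x → P x ⇔ Q x) xs → count P? xs ≡ count Q? xs
count-cong P? Q? Listᴬ.[] = refl
count-cong P? Q? {x List.∷ xs} (P⇔Q Listᴬ.∷ eqs) with P? x | Q? x
... | yes _ | yes _ = cong suc (count-cong P? Q? eqs)
... | no _  | no _  = count-cong P? Q? eqs
... | yes p | no ¬q = contradiction (to P⇔Q p) ¬q
... | no ¬p | yes q = contradiction (from P⇔Q q) ¬p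

count-++ : ∀ {A : Set} {P : Pred A 0ℓ} (P? : Decidable P) xs ys →
  count P? (xs List.++ ys) ≡ count P? xs ℕ.+ count P? ys
count-++ P? xs ys = trans (cong length (Listₚ.filter-++ P? xs ys)) (Listₚ.length-++ (filter P? xs))

count-map : ∀ {A B : Set} {P : Pred B 0ℓ} (P? : Decidable P) (f : A → B) xs →
  count P? (List.map f xs) ≡ count (P? ∘ f) xs
count-map P? f List.[] = refl
count-map P? f (x List.∷ xs) with P? (f x)
... | yes _ = cong suc (count-map P? f xs)
... | no _  = count-map P? f xs

count-none : ∀ {A : Set} {P : Pred A 0ℓ} (P? : Decidable P) {xs} →
  Listᴬ.All (¬_ ∘ P) xs → count P? xs ≡ 0
count-none P? ¬Ps = cong length (Listₚ.filter-none P? ¬Ps)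

-- One entry per choice of positions: equal letters are not merged, so counting entries counts
-- occurrences.
subwords : ∀ {A : Set} {m} → Vec A m → ∀ k → List (Vec A k)
subwords w       zero    = [] List.∷ List.[]
subwords []      (suc k) = List.[]
subwords (x ∷ w) (suc k) = List.map (x ∷_) (subwords w k) List.++ subwords w (suc k)

subwords-All : ∀ {A : Set} {P : Pred A 0ℓ} {m} {w : Vec A m} → All P w →
  ∀ k → Listᴬ.All (All P) (subwords w k)
subwords-All Pw       zero    = [] Listᴬ.∷ Listᴬ.[]
subwords-All []       (suc k) = Listᴬ.[]
subwords-All (p ∷ Pw) (suc k) =
  Listᴬₚ.++⁺ (Listᴬₚ.map⁺ (Listᴬ.map (p ∷_) (subwords-All Pw k))) (subwords-All Pw (suc k))

Match : ∀ {k} → Vec ℕ k → Vec ℕ k → Set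
Match p v = ∀ j l → lookup p j ℕ.< lookup p l ⇔ lookup v j ℕ.< lookup v l

-- Opaque, because unification would otherwise unfold the decision procedure in every count.
abstract
  match? : ∀ {k} (p : Vec ℕ k) → Decidable (Match p)
  match? p v = Finₚ.all? λ j → Finₚ.all? λ l →
    (lookup p j ℕₚ.<? lookup p l) ⇔-dec (lookup v j ℕₚ.<? lookup v l)

occ : ∀ {k m} → Vec ℕ k → Vec ℕ m → ℕ
occ {k} p w = count (match? p) (subwords w k)

Match-tail : ∀ {k a x} {p v : Vec ℕ k} → Match (a ∷ p) (x ∷ v) → Match p v
Match-tail M j l = M (suc j) (suc l)

⇔-yes : ∀ {A B : Set} → A → B → A ⇔ B
⇔-yes a b = mk⇔ (λ _ → b) (λ _ → a)

⇔-no : ∀ {A B : Set} → ¬ A → ¬ B → A ⇔ B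
⇔-no ¬a ¬b = mk⇔ (λ a → contradiction a ¬a) (λ b → contradiction b ¬b)

Match-∷ : ∀ {k a x} {p v : Vec ℕ k} → Match p v →
  (∀ j → a ℕ.< lookup p j ⇔ x ℕ.< lookup v j) →
  (∀ j → lookup p j ℕ.< a ⇔ lookup v j ℕ.< x) → Match (a ∷ p) (x ∷ v)
Match-∷ M up down zero    zero    = ⇔-no (ℕₚ.<-irrefl refl) (ℕₚ.<-irrefl refl)
Match-∷ M up down zero    (suc l) = up l
Match-∷ M up down (suc j) zero    = down j
Match-∷ M up down (suc j) (suc l) = M j l

Match-max-∷ : ∀ {k a x} {p v : Vec ℕ k} → All (ℕ._< a) p → All (ℕ._< x) v →
  Match (a ∷ p) (x ∷ v) ⇔ Match p v
Match-max-∷ p<a v<x = mk⇔ Match-tail λ M → Match-∷ M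
  (λ j → ⇔-no (ℕₚ.<-asym (Allₚ.lookup⁺ p<a j)) (ℕₚ.<-asym (Allₚ.lookup⁺ v<x j)))
  (λ j → ⇔-yes (Allₚ.lookup⁺ p<a j) (Allₚ.lookup⁺ v<x j))

Match-ascent-∷ : ∀ {k a b x y} {p v : Vec ℕ k} → a ℕ.< b → All (ℕ._< a) p → x ℕ.< y → All (ℕ._< x) v →
  Match (a ∷ b ∷ p) (x ∷ y ∷ v) ⇔ Match p v
Match-ascent-∷ {a = a} {b} {x} {y} {p} {v} a<b p<a x<y v<x =
  mk⇔ (λ M → Match-tail (Match-tail M)) λ M → Match-∷ (from (Match-max-∷ p<b v<y) M) up down
  where
  p<b : All (ℕ._< b) p
  p<b = All.map (λ c<a → ℕₚ.<-trans c<a a<b) p<a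
  v<y : All (ℕ._< y) v
  v<y = All.map (λ z<x → ℕₚ.<-trans z<x x<y) v<x
  up : ∀ j → a ℕ.< lookup (b ∷ p) j ⇔ x ℕ.< lookup (y ∷ v) j
  up zero    = ⇔-yes a<b x<y
  up (suc j) = ⇔-no (ℕₚ.<-asym (Allₚ.lookup⁺ p<a j)) (ℕₚ.<-asym (Allₚ.lookup⁺ v<x j))
  down : ∀ j → lookup (b ∷ p) j ℕ.< a ⇔ lookup (y ∷ v) j ℕ.< x
  down zero    = ⇔-no (ℕₚ.<-asym a<b) (ℕₚ.<-asym x<y)
  down (suc j) = ⇔-yes (Allₚ.lookup⁺ p<a j) (Allₚ.lookup⁺ v<x j)

occ-∷ : ∀ {k m} a (p : Vec ℕ k) x (w : Vec ℕ m) →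
  occ (a ∷ p) (x ∷ w) ≡ count (match? (a ∷ p) ∘ (x ∷_)) (subwords w k) ℕ.+ occ (a ∷ p) w
occ-∷ {k} a p x w = trans
  (count-++ (match? (a ∷ p)) (List.map (x ∷_) (subwords w k)) (subwords w (suc k)))
  (cong (ℕ._+ occ (a ∷ p) w) (count-map (match? (a ∷ p)) (x ∷_) (subwords w k)))

occ-max-∷ : ∀ {k m a} {p : Vec ℕ k} {x} {w : Vec ℕ m} → All (ℕ._< a) p → All (ℕ._< x) w →
  occ (a ∷ p) (x ∷ w) ≡ occ p w ℕ.+ occ (a ∷ p) w
occ-max-∷ {k} {a = a} {p} {x} {w} p<a w<x = trans (occ-∷ a p x w)
  (cong (ℕ._+ occ (a ∷ p) w)
    (count-cong (match? (a ∷ p) ∘ (x ∷_)) (match? p) (Listᴬ.map (Match-max-∷ p<a) (subwords-All w<x k))))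

-- A match starting with x would need a later letter above x in the place of p_j.
occ-nonmax-∷ : ∀ {k m a} {p : Vec ℕ k} {x} {w : Vec ℕ m} (j : Fin k) →
  a ℕ.< lookup p j → All (ℕ._< x) w →
  occ (a ∷ p) (x ∷ w) ≡ occ (a ∷ p) w
occ-nonmax-∷ {k} {a = a} {p} {x} {w} j a<p w<x = trans (occ-∷ a p x w)
  (cong (ℕ._+ occ (a ∷ p) w)
    (count-none (match? (a ∷ p) ∘ (x ∷_))
      (Listᴬ.map (λ v<x M → ℕₚ.<-asym (Allₚ.lookup⁺ v<x j) (to (M zero (suc j)) a<p))
        (subwords-All w<x k))))

module _ {m s t} {w : Vec ℕ m} (s<t : s ℕ.< t) (w<s : All (ℕ._< s) w) where

  w<t : All (ℕ._< t) w
  w<t = All.map (λ z<s → ℕₚ.<-trans z<s s<t) w<s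

  -- The three summands are the subwords that use both `s` and `t`, those that use `s` without `t`,
  -- and those that avoid `s`.
  occ-∷-∷ : ∀ {k} a b (p : Vec ℕ k) → occ (a ∷ b ∷ p) (s ∷ t ∷ w) ≡
    count (match? (a ∷ b ∷ p) ∘ (s ∷_) ∘ (t ∷_)) (subwords w k) ℕ.+
    count (match? (a ∷ b ∷ p) ∘ (s ∷_)) (subwords w (suc k)) ℕ.+ occ (a ∷ b ∷ p) (t ∷ w)
  occ-∷-∷ {k} a b p = trans (occ-∷ a (b ∷ p) s (t ∷ w)) (cong (ℕ._+ occ (a ∷ b ∷ p) (t ∷ w)) (trans
    (count-++ (match? (a ∷ b ∷ p) ∘ (s ∷_)) (List.map (t ∷_) (subwords w k)) (subwords w (suc k)))
    (cong (ℕ._+ count (match? (a ∷ b ∷ p) ∘ (s ∷_)) (subwords w (suc k)))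
      (count-map (match? (a ∷ b ∷ p) ∘ (s ∷_)) (t ∷_) (subwords w k)))))

  -- A pattern with a maximum in front starts with a descent, so the ascent `s`, `t` cannot supply
  -- its first two letters. Either of them alone can play `a`, with `p` matched inside `w`; hence
  -- the two copies.
  occ-max-∷-∷ : ∀ {k a} {p : Vec ℕ k} → All (ℕ._< a) p →
    occ (a ∷ p) (s ∷ t ∷ w) ≡ occ p w ℕ.+ (occ p w ℕ.+ occ (a ∷ p) w)
  -- A one-letter pattern has no second letter, so the three-way split does not apply.
  occ-max-∷-∷ {a = a} {[]} [] = trans (occ-∷ a [] s (t ∷ w)) (cong₂ ℕ._+_
    (count-cong (match? (a ∷ []) ∘ (s ∷_)) (match? []) (Match-max-∷ [] [] Listᴬ.∷ Listᴬ.[]))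
    (occ-max-∷ [] w<t))
  occ-max-∷-∷ {suc k} {a} {b ∷ p} (b<a ∷ p<a) = trans (occ-∷-∷ a b p) (cong₂ ℕ._+_
    (cong₂ ℕ._+_
      (count-none (match? (a ∷ b ∷ p) ∘ (s ∷_) ∘ (t ∷_))
        (Listᴬ.universal (λ v M → ℕₚ.<-asym s<t (to (M (suc zero) zero) b<a)) (subwords w k)))
      (count-cong (match? (a ∷ b ∷ p) ∘ (s ∷_)) (match? (b ∷ p))
        (Listᴬ.map (Match-max-∷ (b<a ∷ p<a)) (subwords-All w<s (suc k)))))
    (occ-max-∷ (b<a ∷ p<a) w<t))

  -- With both letters used, `s` and `t` play `a` and `b`, and the rest must match `p`. If only one
  -- of them is used, it exceeds every later letter of the subword, and nothing can play `b`.
  occ-ascent-∷-∷ : ∀ {k a b} {p : Vec ℕ k} → a ℕ.< b → All (ℕ._< a) p →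
    occ (a ∷ b ∷ p) (s ∷ t ∷ w) ≡ occ p w ℕ.+ occ (a ∷ b ∷ p) w
  occ-ascent-∷-∷ {k} {a} {b} {p} a<b p<a = trans (occ-∷-∷ a b p) (cong₂ ℕ._+_
    (trans (cong₂ ℕ._+_
      (count-cong (match? (a ∷ b ∷ p) ∘ (s ∷_) ∘ (t ∷_)) (match? p)
        (Listᴬ.map (Match-ascent-∷ a<b p<a s<t) (subwords-All w<s k)))
      (count-none (match? (a ∷ b ∷ p) ∘ (s ∷_))
        (Listᴬ.map (λ v<s M → ℕₚ.<-asym (Allₚ.lookup⁺ v<s zero) (to (M zero (suc zero)) a<b))
          (subwords-All w<s (suc k)))))
      (ℕₚ.+-identityʳ _))
    (occ-nonmax-∷ zero a<b w<t))

  -- The letter in the place of p_j comes at least two places after the first, so it lies in `w`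
  -- whether `s` or `t` starts the match, and `w` is below both. An ascent `a < b` alone would not
  -- do, as `s` and `t` can play it.
  occ-nonmax-∷-∷ : ∀ {k a b} {p : Vec ℕ k} (j : Fin k) → a ℕ.< lookup p j →
    occ (a ∷ b ∷ p) (s ∷ t ∷ w) ≡ occ (a ∷ b ∷ p) w
  occ-nonmax-∷-∷ {k} {a} {b} {p} j a<p = trans (occ-∷-∷ a b p) (cong₂ ℕ._+_
    (cong₂ ℕ._+_
      (count-none (match? (a ∷ b ∷ p) ∘ (s ∷_) ∘ (t ∷_))
        (Listᴬ.map (λ v<s M → ℕₚ.<-asym (Allₚ.lookup⁺ v<s j) (to (M zero (suc (suc j))) a<p))
          (subwords-All w<s k)))
      (count-none (match? (a ∷ b ∷ p) ∘ (s ∷_))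
        (Listᴬ.map (λ v<s M → ℕₚ.<-asym (Allₚ.lookup⁺ v<s (suc j)) (to (M zero (suc (suc j))) a<p))
          (subwords-All w<s (suc k)))))
    (occ-nonmax-∷ (suc j) a<p w<t))

-- From index words to subwords

unique∧⇔⇒↭ : ∀ {A : Set} {xs ys : List A} → Unique xs → Unique ys →
  (∀ {x} → x ∈ xs ⇔ x ∈ ys) → xs ↭ ys
unique∧⇔⇒↭ xs! ys! xs⇔ys = ∼bag⇒↭ (unique∧set⇒bag xs! ys! xs⇔ys)

words-complete : ∀ {n k} (w : Word n k) → w ∈ words n k
words-complete []      = here refl
words-complete (i ∷ w) = ∈ₚ.∈-cartesianProductWith⁺ _∷_ (∈ₚ.∈-allFin i) (words-complete w)

words-unique : ∀ n k → Unique (words n k)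
words-unique n zero    = Listᴬ.[] Listᴾ.∷ Listᴾ.[]
words-unique n (suc k) =
  Uniqueₚ.cartesianProductWith⁺ _∷_ (λ { refl → refl , refl }) (Uniqueₚ.allFin⁺ n) (words-unique n k)

subwords-map : ∀ {A B : Set} (f : A → B) {m} (w : Vec A m) k →
  subwords (Vec.map f w) k ≡ List.map (Vec.map f) (subwords w k)
subwords-map f w       zero    = refl
subwords-map f []      (suc k) = refl
subwords-map f (x ∷ w) (suc k) = begin
  List.map (f x ∷_) (subwords (Vec.map f w) k) List.++ subwords (Vec.map f w) (suc k)
    ≡⟨ cong₂ (λ us vs → List.map (f x ∷_) us List.++ vs) (subwords-map f w k) (subwords-map f w (suc k)) ⟩
  List.map (f x ∷_) (List.map (Vec.map f) (subwords w k)) List.++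
  List.map (Vec.map f) (subwords w (suc k))
    -- Both composites send `v` to `f x ∷ Vec.map f v`, so fusing the maps one way and splitting
    -- them the other way suffices.
    ≡⟨ cong (List._++ _) (trans (sym (Listₚ.map-∘ (subwords w k))) (Listₚ.map-∘ (subwords w k))) ⟩
  List.map (Vec.map f) (List.map (x ∷_) (subwords w k)) List.++
  List.map (Vec.map f) (subwords w (suc k))
    ≡⟨ Listₚ.map-++ (Vec.map f) (List.map (x ∷_) (subwords w k)) _ ⟨
  List.map (Vec.map f) (List.map (x ∷_) (subwords w k) List.++ subwords w (suc k)) ∎
  where open ≡-Reasoning

subwords-AllPairs : ∀ {A : Set} {R : A → A → Set} {m} {w : Vec A m} → AllPairs R w →
  ∀ k → Listᴬ.All (AllPairs R) (subwords w k)
subwords-AllPairs Rw       zero    = [] Listᴬ.∷ Listᴬ.[]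
subwords-AllPairs []       (suc k) = Listᴬ.[]
subwords-AllPairs (r ∷ Rw) (suc k) = Listᴬₚ.++⁺
  (Listᴬₚ.map⁺ (Listᴬ.zipWith (λ (rv , Rv) → rv ∷ Rv) (subwords-All r k , subwords-AllPairs Rw k)))
  (subwords-AllPairs Rw (suc k))

subwords-unique : ∀ {A : Set} {m} {w : Vec A m} → AllPairs _≢_ w → ∀ k → Unique (subwords w k)
subwords-unique w!       zero    = Listᴬ.[] Listᴾ.∷ Listᴾ.[]
subwords-unique []       (suc k) = Listᴾ.[]
subwords-unique {w = x ∷ w} (x∉w ∷ w!) (suc k) = Uniqueₚ.++⁺
  (Uniqueₚ.map⁺ Vecₚ.∷-injectiveʳ (subwords-unique w! k))
  (subwords-unique w! (suc k))
  disjoint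
  where
  disjoint : ∀ {v} → ¬ (v ∈ List.map (x ∷_) (subwords w k) × v ∈ subwords w (suc k))
  disjoint (v∈₁ , v∈₂) with ∈ₚ.∈-map⁻ (x ∷_) v∈₁
  ... | _ , _ , refl = All.head (Listᴬ.lookup (subwords-All x∉w (suc k)) v∈₂) refl

AllPairs⇒Linked : ∀ {A : Set} {R : A → A → Set} {m} {w : Vec A m} → AllPairs R w → Linked R w
AllPairs⇒Linked []                     = []
AllPairs⇒Linked (_ ∷ [])               = [-]
AllPairs⇒Linked ((r ∷ _) ∷ Rw@(_ ∷ _)) = r ∷ AllPairs⇒Linked Rw

Linked⇒All-tail : ∀ {n k} {i : Fin n} {ι : Word n k} → Linked Fin._<_ (i ∷ ι) → All (i Fin.<_) ι
Linked⇒All-tail [-]         = []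
Linked⇒All-tail (i<j ∷ j∷ι) = Linkedₚ.Linked⇒All Finₚ.<-trans i<j j∷ι

allFin-suc : ∀ n → Vec.allFin (suc n) ≡ zero ∷ Vec.map suc (Vec.allFin n)
allFin-suc n = cong (zero ∷_) (Vecₚ.tabulate-∘ suc id)

allFin-increasing : ∀ n → AllPairs Fin._<_ (Vec.allFin n)
allFin-increasing zero    = []
allFin-increasing (suc n) = subst (AllPairs Fin._<_) (sym (allFin-suc n))
  (Allₚ.map⁺ (All.universal (λ _ → z<s) _) ∷ AllPairsₚ.map⁺ (AllPairs.map s<s (allFin-increasing n)))

unsuc : ∀ {n k} {ι : Word (suc n) k} → All (zero {n} Fin.<_) ι →
  ∃ λ (κ : Word n k) → ι ≡ Vec.map suc κ
unsuc []                      = [] , refl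
unsuc {ι = suc i ∷ _} (_ ∷ ps) = Product.map (i ∷_) (cong (suc i ∷_)) (unsuc ps)

-- Whether or not the word starts with position 0, the remaining positions are positive. They are
-- thus the `suc` image of an increasing word over `Fin n`, to which the induction applies.
increasing∈subwords : ∀ {n k} {ι : Word n k} → Linked Fin._<_ ι → ι ∈ subwords (Vec.allFin n) k
increasing∈subwords {ι = []} _ = here refl
increasing∈subwords {suc n} {suc k} {i ∷ ι} ι↑ =
  subst (λ w → i ∷ ι ∈ subwords w (suc k)) (sym (allFin-suc n)) (go i ι↑)
  where
  shifted : ∀ {l} (κ : Word n l) → Linked Fin._<_ (Vec.map suc κ) →
    Vec.map suc κ ∈ subwords (Vec.map suc (Vec.allFin n)) l
  shifted κ κ↑ = subst (Vec.map suc κ ∈_) (sym (subwords-map suc (Vec.allFin n) _))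
    (∈ₚ.∈-map⁺ (Vec.map suc) (increasing∈subwords (Linked.map s<s⁻¹ (Linkedₚ.map⁻ κ↑))))
  go : ∀ i → Linked Fin._<_ (i ∷ ι) → i ∷ ι ∈ subwords (zero ∷ Vec.map suc (Vec.allFin n)) (suc k)
  go zero ι↑ with unsuc (Linked⇒All-tail ι↑)
  ... | κ , refl = ∈ₚ.∈-++⁺ˡ (∈ₚ.∈-map⁺ (zero ∷_) (shifted κ (Linked.tail ι↑)))
  go (suc i) ι↑ with unsuc (z<s ∷ All.map (ℕₚ.<-trans z<s) (Linked⇒All-tail ι↑))
  ... | κ@(_ ∷ _) , refl = ∈ₚ.∈-++⁺ʳ _ (shifted κ ι↑)

occ-word : ∀ {k n m} → Vec ℕ k → Word n m → ℕ
occ-word p σ = occ p (Vec.map toℕ σ)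

-- The increasing index words are exactly the subwords of `allFin n`, each listed once. Mapping
-- `lookup σ` over them turns choices of positions into subwords of `σ`.
occurrences≡occ : ∀ {k n} (q : Word k k) (σ : Word n n) → occurrences q σ ≡
  occ-word (Vec.map toℕ q) σ
occurrences≡occ {k} {n} q σ = begin
  occurrences q σ
    ≡⟨ ↭ₚ.↭-length (unique∧⇔⇒↭
         (Uniqueₚ.filter⁺ (isOccurrence? q σ) (words-unique n k))
         (Uniqueₚ.filter⁺ (isOccurrence? q σ)
           (subwords-unique (AllPairs.map Finₚ.<⇒≢ (allFin-increasing n)) k))
         (mk⇔ (λ ι∈ → let occurs = proj₂ (∈ₚ.∈-filter⁻ (isOccurrence? q σ) {xs = words n k} ι∈) in
                 ∈ₚ.∈-filter⁺ (isOccurrence? q σ) (increasing∈subwords (proj₁ occurs)) occurs)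
              (λ ι∈ → ∈ₚ.∈-filter⁺ (isOccurrence? q σ) (words-complete _)
                 (proj₂ (∈ₚ.∈-filter⁻ (isOccurrence? q σ) {xs = subwords (Vec.allFin n) k} ι∈))))) ⟩
  count (isOccurrence? q σ) (subwords (Vec.allFin n) k)
    ≡⟨ count-cong (isOccurrence? q σ) (match? p ∘ Vec.map σ′)
         (Listᴬ.map occurs⇔match (subwords-AllPairs (allFin-increasing n) k)) ⟩
  count (match? p ∘ Vec.map σ′) (subwords (Vec.allFin n) k)
    ≡⟨ count-map (match? p) (Vec.map σ′) (subwords (Vec.allFin n) k) ⟨
  count (match? p) (List.map (Vec.map σ′) (subwords (Vec.allFin n) k))
    ≡⟨ cong (count (match? p)) (subwords-map σ′ (Vec.allFin n) k) ⟨
  occ p (Vec.map σ′ (Vec.allFin n))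
    ≡⟨ cong (occ p) (trans (Vecₚ.map-∘ toℕ (lookup σ) (Vec.allFin n))
         (cong (Vec.map toℕ) (Vecₚ.map-lookup-allFin σ))) ⟩
  occ-word p σ ∎
  where
  open ≡-Reasoning
  p = Vec.map toℕ q
  σ′ : Fin n → ℕ
  σ′ = toℕ ∘ lookup σ
  occurs⇔match : ∀ {ι} → AllPairs Fin._<_ ι → IsOccurrence q σ ι ⇔ Match p (Vec.map σ′ ι)
  occurs⇔match {ι} ι↑ = mk⇔
    (λ (_ , M) j l → subst₂ _⇔_ (sym (p≡ j l)) (sym (σ≡ j l)) (M j l))
    (λ M → AllPairs⇒Linked ι↑ , λ j l → subst₂ _⇔_ (p≡ j l) (σ≡ j l) (M j l))
    where
    p≡ : ∀ j l → (lookup p j ℕ.< lookup p l) ≡ (lookup q j Fin.< lookup q l)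
    p≡ j l = cong₂ ℕ._<_ (Vecₚ.lookup-map j toℕ q) (Vecₚ.lookup-map l toℕ q)
    σ≡ : ∀ j l → (lookup (Vec.map σ′ ι) j ℕ.< lookup (Vec.map σ′ ι) l) ≡
                 (lookup σ (lookup ι j) Fin.< lookup σ (lookup ι l))
    σ≡ j l = cong₂ ℕ._<_ (Vecₚ.lookup-map j σ′ ι) (Vecₚ.lookup-map l σ′ ι)

-- Structure of the permutations avoiding 123, 132 and 213

prefix₁ : ∀ {n m} → Word n m → Word (suc n) (suc m)
prefix₁ {n} σ = fromℕ n ∷ Vec.map inject₁ σ

prefix₂ : ∀ {n m} → Word n m → Word (suc (suc n)) (suc (suc m))
prefix₂ {n} σ = inject₁ (fromℕ n) ∷ fromℕ (suc n) ∷ Vec.map inject₁ (Vec.map inject₁ σ)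

-- The reverse layered permutations with blocks of size one or two, one for each composition of `n`
-- into ones and twos.
layered : ∀ n → List (Word n n)
layered 0             = [] List.∷ List.[]
layered 1             = List.map prefix₁ (layered 0)
layered (suc (suc n)) = List.map prefix₁ (layered (suc n)) List.++ List.map prefix₂ (layered n)

map-toℕ-inject₁ : ∀ {n m} (σ : Word n m) → Vec.map toℕ (Vec.map inject₁ σ) ≡ Vec.map toℕ σ
map-toℕ-inject₁ σ = trans (sym (Vecₚ.map-∘ toℕ inject₁ σ)) (Vecₚ.map-cong Finₚ.toℕ-inject₁ σ)

toℕ-prefix₁ : ∀ {n m} (σ : Word n m) → Vec.map toℕ (prefix₁ σ) ≡ n ∷ Vec.map toℕ σ
toℕ-prefix₁ {n} σ = cong₂ _∷_ (Finₚ.toℕ-fromℕ n) (map-toℕ-inject₁ σ)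

toℕ-prefix₂ : ∀ {n m} (σ : Word n m) → Vec.map toℕ (prefix₂ σ) ≡ n ∷ suc n ∷ Vec.map toℕ σ
toℕ-prefix₂ {n} σ = cong₂ _∷_ (trans (Finₚ.toℕ-inject₁ (fromℕ n)) (Finₚ.toℕ-fromℕ n))
  (cong₂ _∷_ (Finₚ.toℕ-fromℕ (suc n))
    (trans (map-toℕ-inject₁ (Vec.map inject₁ σ)) (map-toℕ-inject₁ σ)))

toℕ-bounded : ∀ {n m} (σ : Word n m) → All (ℕ._< n) (Vec.map toℕ σ)
toℕ-bounded σ = Allₚ.map⁺ (All.universal Finₚ.toℕ<n σ)

-- Totals over `layered` and their recurrences

sum-map-+ : ∀ {A : Set} (g h k : A → ℕ) → (∀ x → g x ≡ h x ℕ.+ k x) →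
  ∀ xs → sum (List.map g xs) ≡ sum (List.map h xs) ℕ.+ sum (List.map k xs)
sum-map-+ g h k g≗h+k List.[]       = refl
sum-map-+ g h k g≗h+k (x List.∷ xs) = begin
  g x ℕ.+ sum (List.map g xs)
    ≡⟨ cong₂ ℕ._+_ (g≗h+k x) (sum-map-+ g h k g≗h+k xs) ⟩
  (h x ℕ.+ k x) ℕ.+ (sum (List.map h xs) ℕ.+ sum (List.map k xs))
    ≡⟨ interchange (h x) (k x) _ _ ⟩
  (h x ℕ.+ sum (List.map h xs)) ℕ.+ (k x ℕ.+ sum (List.map k xs)) ∎
  where
  open ≡-Reasoning
  open import Algebra.Properties.CommutativeSemigroup ℕₚ.+-commutativeSemigroup using (interchange)

total : ∀ {k} → Vec ℕ k → ℕ → ℕ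
total p n = sum (List.map (occ-word p) (layered n))

total-suc² : ∀ {k} (p : Vec ℕ k) n → total p (suc (suc n)) ≡
  sum (List.map (occ-word p ∘ prefix₁) (layered (suc n))) ℕ.+
  sum (List.map (occ-word p ∘ prefix₂) (layered n))
total-suc² p n = begin
  total p (suc (suc n))
    ≡⟨ cong sum (Listₚ.map-++ (occ-word p) (List.map prefix₁ (layered (suc n)))
         (List.map prefix₂ (layered n))) ⟩
  sum (List.map (occ-word p) (List.map prefix₁ (layered (suc n))) List.++
       List.map (occ-word p) (List.map prefix₂ (layered n)))
    ≡⟨ cong₂ (λ us vs → sum (us List.++ vs)) (Listₚ.map-∘ (layered (suc n))) (Listₚ.map-∘ (layered n)) ⟨
  sum (List.map (occ-word p ∘ prefix₁) (layered (suc n)) List.++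
       List.map (occ-word p ∘ prefix₂) (layered n))
    ≡⟨ sum-++ (List.map (occ-word p ∘ prefix₁) (layered (suc n))) _ ⟩
  sum (List.map (occ-word p ∘ prefix₁) (layered (suc n))) ℕ.+
  sum (List.map (occ-word p ∘ prefix₂) (layered n)) ∎
  where open ≡-Reasoning

-- `match?` is abstract, so this count does not compute; the matching condition holds vacuously.
occ-[] : ∀ {m} (w : Vec ℕ m) → occ [] w ≡ 1
occ-[] w = cong length (Listₚ.filter-accept (match? []) {xs = List.[]} (λ ()))

module _ {n m} (σ : Word n m) where

  occ-prefix₁-max : ∀ {k a} {p : Vec ℕ k} → All (ℕ._< a) p →
    occ-word (a ∷ p) (prefix₁ σ) ≡ occ-word p σ ℕ.+ occ-word (a ∷ p) σ
  occ-prefix₁-max {a = a} {p} p<a = trans (cong (occ (a ∷ p)) (toℕ-prefix₁ σ))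
    (occ-max-∷ p<a (toℕ-bounded σ))

  occ-prefix₁-nonmax : ∀ {k a} {p : Vec ℕ k} j → a ℕ.< lookup p j →
    occ-word (a ∷ p) (prefix₁ σ) ≡ occ-word (a ∷ p) σ
  occ-prefix₁-nonmax {a = a} {p} j a<p = trans (cong (occ (a ∷ p)) (toℕ-prefix₁ σ))
    (occ-nonmax-∷ j a<p (toℕ-bounded σ))

  occ-prefix₂-max : ∀ {k a} {p : Vec ℕ k} → All (ℕ._< a) p →
    occ-word (a ∷ p) (prefix₂ σ) ≡ occ-word p σ ℕ.+ (occ-word p σ ℕ.+ occ-word (a ∷ p) σ)
  occ-prefix₂-max {a = a} {p} p<a = trans (cong (occ (a ∷ p)) (toℕ-prefix₂ σ))
    (occ-max-∷-∷ (ℕₚ.n<1+n n) (toℕ-bounded σ) p<a)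

  occ-prefix₂-ascent : ∀ {k a b} {p : Vec ℕ k} → a ℕ.< b → All (ℕ._< a) p →
    occ-word (a ∷ b ∷ p) (prefix₂ σ) ≡ occ-word p σ ℕ.+ occ-word (a ∷ b ∷ p) σ
  occ-prefix₂-ascent {a = a} {b} {p} a<b p<a = trans (cong (occ (a ∷ b ∷ p)) (toℕ-prefix₂ σ))
    (occ-ascent-∷-∷ (ℕₚ.n<1+n n) (toℕ-bounded σ) a<b p<a)

  occ-prefix₂-nonmax : ∀ {k a b} {p : Vec ℕ k} j → a ℕ.< lookup p j →
    occ-word (a ∷ b ∷ p) (prefix₂ σ) ≡ occ-word (a ∷ b ∷ p) σ
  occ-prefix₂-nonmax {a = a} {b} {p} j a<p = trans (cong (occ (a ∷ b ∷ p)) (toℕ-prefix₂ σ))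
    (occ-nonmax-∷-∷ (ℕₚ.n<1+n n) (toℕ-bounded σ) j a<p)

module _ {k a} {p : Vec ℕ k} (p<a : All (ℕ._< a) p) where

  total-max-1 : total (a ∷ p) 1 ≡ total p 0 ℕ.+ total (a ∷ p) 0
  total-max-1 = sum-map-+ (occ-word (a ∷ p) ∘ prefix₁) (occ-word p) (occ-word (a ∷ p))
    (λ σ → occ-prefix₁-max σ p<a) (layered 0)

  total-max : ∀ n → total (a ∷ p) (suc (suc n)) ≡
    (total p (suc n) ℕ.+ total (a ∷ p) (suc n)) ℕ.+ (total p n ℕ.+ (total p n ℕ.+ total (a ∷ p) n))
  total-max n = trans (total-suc² (a ∷ p) n) (cong₂ ℕ._+_
    (sum-map-+ (occ-word (a ∷ p) ∘ prefix₁) (occ-word p) (occ-word (a ∷ p))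
      (λ σ → occ-prefix₁-max σ p<a) (layered (suc n)))
    (trans
      (sum-map-+ (occ-word (a ∷ p) ∘ prefix₂) (occ-word p) (λ σ → occ-word p σ ℕ.+ occ-word (a ∷ p) σ)
        (λ σ → occ-prefix₂-max σ p<a) (layered n))
      (cong (total p n ℕ.+_)
        (sum-map-+ _ (occ-word p) (occ-word (a ∷ p)) (λ _ → refl) (layered n)))))

module _ {k a b} {p : Vec ℕ k} (a<b : a ℕ.< b) (p<a : All (ℕ._< a) p) where

  total-ascent-1 : total (a ∷ b ∷ p) 1 ≡ total (a ∷ b ∷ p) 0
  total-ascent-1 = cong sum (Listₚ.map-cong (λ σ → occ-prefix₁-nonmax σ {p = b ∷ p} zero a<b) (layered 0))

  total-ascent : ∀ n → total (a ∷ b ∷ p) (suc (suc n)) ≡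
    total (a ∷ b ∷ p) (suc n) ℕ.+ (total p n ℕ.+ total (a ∷ b ∷ p) n)
  total-ascent n = trans (total-suc² (a ∷ b ∷ p) n) (cong₂ ℕ._+_
    (cong sum (Listₚ.map-cong (λ σ → occ-prefix₁-nonmax σ zero a<b) (layered (suc n))))
    (sum-map-+ (occ-word (a ∷ b ∷ p) ∘ prefix₂) (occ-word p) (occ-word (a ∷ b ∷ p))
      (λ σ → occ-prefix₂-ascent σ a<b p<a) (layered n)))

-- Injectivity, and avoidance under the two prefixes

map-injective : ∀ {A B : Set} {f : A → B} → Injective _≡_ _≡_ f → ∀ {n} →
  Injective _≡_ _≡_ (λ (v : Vec A n) → Vec.map f v)
map-injective f-inj {x = []}    {[]}    _  = refl
map-injective f-inj {x = _ ∷ _} {_ ∷ _} eq =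
  cong₂ _∷_ (f-inj (Vecₚ.∷-injectiveˡ eq)) (map-injective f-inj (Vecₚ.∷-injectiveʳ eq))

layered-unique : ∀ n → Unique (layered n)
layered-unique 0             = Listᴬ.[] Listᴾ.∷ Listᴾ.[]
layered-unique 1             = Listᴬ.[] Listᴾ.∷ Listᴾ.[]
layered-unique (suc (suc n)) = Uniqueₚ.++⁺
  (Uniqueₚ.map⁺ (map-injective Finₚ.inject₁-injective ∘ Vecₚ.∷-injectiveʳ) (layered-unique (suc n)))
  (Uniqueₚ.map⁺ (map-injective Finₚ.inject₁-injective ∘ map-injective Finₚ.inject₁-injective ∘
    Vecₚ.∷-injectiveʳ ∘ Vecₚ.∷-injectiveʳ) (layered-unique n))
  disjoint
  where
  disjoint : ∀ {τ} → ¬ (τ ∈ List.map prefix₁ (layered (suc n)) × τ ∈ List.map prefix₂ (layered n))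
  disjoint (τ∈₁ , τ∈₂) with ∈ₚ.∈-map⁻ prefix₁ τ∈₁ | ∈ₚ.∈-map⁻ prefix₂ τ∈₂
  ... | _ , _ , refl | _ , _ , eq = Finₚ.fromℕ≢inject₁ (Vecₚ.∷-injectiveˡ eq)

-- Pigeonhole: if `y` were missed, `punchOut` would turn `g` into an injection from `Fin (suc n)` to
-- `Fin n`.
injective⇒surjective : ∀ {n} {g : Fin n → Fin n} → Injective _≡_ _≡_ g → ∀ y → ∃ λ x → g x ≡ y
injective⇒surjective {suc n} {g} g-inj y with Finₚ.any? (λ x → g x Finₚ.≟ y)
... | yes hit = hit
... | no miss = contradiction
  (Finₚ.injective⇒≤ {f = λ x → punchOut (y≢g x)} (g-inj ∘ Finₚ.punchOut-injective (y≢g _) (y≢g _)))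
  ℕₚ.1+n≰n
  where
  y≢g : ∀ x → y ≢ g x
  y≢g x y≡gx = miss (x , sym y≡gx)

∷-lookup-injective : ∀ {A : Set} {n} {x : A} {w : Vec A n} → (∀ i → lookup w i ≢ x) →
  Injective _≡_ _≡_ (lookup w) → Injective _≡_ _≡_ (lookup (x ∷ w))
∷-lookup-injective x∉w inj {zero}  {zero}  _  = refl
∷-lookup-injective x∉w inj {zero}  {suc j} eq = contradiction (sym eq) (x∉w j)
∷-lookup-injective x∉w inj {suc i} {zero}  eq = contradiction eq (x∉w i)
∷-lookup-injective x∉w inj {suc i} {suc j} eq = cong suc (inj eq)

module _ {n m} (σ : Word n m) where

  map-inject₁-injective⁺ : Injective _≡_ _≡_ (lookup σ) → Injective _≡_ _≡_ (lookup (Vec.map inject₁ σ))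
  map-inject₁-injective⁺ inj {i} {j} eq = inj (Finₚ.inject₁-injective
    (trans (sym (Vecₚ.lookup-map i inject₁ σ)) (trans eq (Vecₚ.lookup-map j inject₁ σ))))

  map-inject₁-injective⁻ : Injective _≡_ _≡_ (lookup (Vec.map inject₁ σ)) → Injective _≡_ _≡_ (lookup σ)
  map-inject₁-injective⁻ inj {i} {j} eq = inj
    (trans (Vecₚ.lookup-map i inject₁ σ) (trans (cong inject₁ eq) (sym (Vecₚ.lookup-map j inject₁ σ))))

  fromℕ∉map-inject₁ : ∀ i → lookup (Vec.map inject₁ σ) i ≢ fromℕ n
  fromℕ∉map-inject₁ i eq = Finₚ.fromℕ≢inject₁ (trans (sym eq) (Vecₚ.lookup-map i inject₁ σ))

uninject₁ : ∀ {n m} (w : Word (suc n) m) → (∀ i → lookup w i ≢ fromℕ n) → ∃ λ σ → w ≡ Vec.map inject₁ σ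
uninject₁ []      _   = [] , refl
uninject₁ (x ∷ w) x≢⊤ with view x | uninject₁ w (x≢⊤ ∘ suc)
... | ‵fromℕ     | _        = contradiction refl (x≢⊤ zero)
... | ‵inject₁ i | σ , refl = i ∷ σ , refl

-- Of bijectivity only injectivity is stored, since it passes through prefixes directly;
-- `injective⇒surjective` restores the rest.
record Avoider {n} (σ : Word n n) : Set where
  field
    injective  : Injective _≡_ _≡_ (lookup σ)
    avoids-123 : occ-word (Vec.map toℕ p123) σ ≡ 0
    avoids-132 : occ-word (Vec.map toℕ p132) σ ≡ 0
    avoids-213 : occ-word (Vec.map toℕ p213) σ ≡ 0

module _ {n m} (σ : Word n m) where

  occ-123-prefix₁ : occ-word (Vec.map toℕ p123) (prefix₁ σ) ≡ occ-word (Vec.map toℕ p123) σ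
  occ-123-prefix₁ = occ-prefix₁-nonmax σ 0F z<s

  occ-132-prefix₁ : occ-word (Vec.map toℕ p132) (prefix₁ σ) ≡ occ-word (Vec.map toℕ p132) σ
  occ-132-prefix₁ = occ-prefix₁-nonmax σ 0F z<s

  occ-213-prefix₁ : occ-word (Vec.map toℕ p213) (prefix₁ σ) ≡ occ-word (Vec.map toℕ p213) σ
  occ-213-prefix₁ = occ-prefix₁-nonmax σ 1F (s<s z<s)

  occ-123-prefix₂ : occ-word (Vec.map toℕ p123) (prefix₂ σ) ≡ occ-word (Vec.map toℕ p123) σ
  occ-123-prefix₂ = occ-prefix₂-nonmax σ 0F z<s

  occ-132-prefix₂ : occ-word (Vec.map toℕ p132) (prefix₂ σ) ≡ occ-word (Vec.map toℕ p132) σ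
  occ-132-prefix₂ = occ-prefix₂-nonmax σ 0F z<s

  occ-213-prefix₂ : occ-word (Vec.map toℕ p213) (prefix₂ σ) ≡ occ-word (Vec.map toℕ p213) σ
  occ-213-prefix₂ = occ-prefix₂-nonmax σ 0F (s<s z<s)

module _ {n} (σ : Word n n) where

  avoider-prefix₁ : Avoider σ ⇔ Avoider (prefix₁ σ)
  avoider-prefix₁ = mk⇔
    (λ g → let open Avoider g in record
      { injective  = ∷-lookup-injective (fromℕ∉map-inject₁ σ) (map-inject₁-injective⁺ σ injective)
      ; avoids-123 = trans (occ-123-prefix₁ σ) avoids-123
      ; avoids-132 = trans (occ-132-prefix₁ σ) avoids-132
      ; avoids-213 = trans (occ-213-prefix₁ σ) avoids-213
      })
    (λ g → let open Avoider g in record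
      { injective  = map-inject₁-injective⁻ σ (Finₚ.suc-injective ∘ injective)
      ; avoids-123 = trans (sym (occ-123-prefix₁ σ)) avoids-123
      ; avoids-132 = trans (sym (occ-132-prefix₁ σ)) avoids-132
      ; avoids-213 = trans (sym (occ-213-prefix₁ σ)) avoids-213
      })

  avoider-prefix₂ : Avoider σ ⇔ Avoider (prefix₂ σ)
  avoider-prefix₂ = mk⇔
    (λ g → let open Avoider g in record
      { injective  = ∷-lookup-injective
          (λ { zero    → Finₚ.fromℕ≢inject₁
             ; (suc i) eq → fromℕ∉map-inject₁ σ i (Finₚ.inject₁-injective
                 (trans (sym (Vecₚ.lookup-map i inject₁ (Vec.map inject₁ σ))) eq)) })
          (∷-lookup-injective (fromℕ∉map-inject₁ (Vec.map inject₁ σ))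
            (map-inject₁-injective⁺ (Vec.map inject₁ σ) (map-inject₁-injective⁺ σ injective)))
      ; avoids-123 = trans (occ-123-prefix₂ σ) avoids-123
      ; avoids-132 = trans (occ-132-prefix₂ σ) avoids-132
      ; avoids-213 = trans (occ-213-prefix₂ σ) avoids-213
      })
    (λ g → let open Avoider g in record
      { injective  = map-inject₁-injective⁻ σ (map-inject₁-injective⁻ (Vec.map inject₁ σ)
          (Finₚ.suc-injective ∘ Finₚ.suc-injective ∘ injective))
      ; avoids-123 = trans (sym (occ-123-prefix₂ σ)) avoids-123
      ; avoids-132 = trans (sym (occ-132-prefix₂ σ)) avoids-132
      ; avoids-213 = trans (sym (occ-213-prefix₂ σ)) avoids-213
      })

-- The first letters of an avoider

¬occurrence : ∀ {k n} (q : Word k k) (σ : Word n n) → occ-word (Vec.map toℕ q) σ ≡ 0 →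
  ∀ ι → ¬ IsOccurrence q σ ι
¬occurrence {k} {n} q σ none ι occurs =
  nonempty (trans (occurrences≡occ q σ) none) (∈ₚ.∈-filter⁺ (isOccurrence? q σ) (words-complete ι) occurs)
  where
  nonempty : ∀ {A : Set} {x : A} {xs} → length xs ≡ 0 → ¬ x ∈ xs
  nonempty {xs = List.[]} _ ()

sorted-mono : ∀ {n} {x y z : Fin n} → x Fin.< y → y Fin.< z →
  ∀ i j → i Fin.< j ⇔ lookup (x ∷ y ∷ z ∷ []) i Fin.< lookup (x ∷ y ∷ z ∷ []) j
sorted-mono x<y y<z 0F 0F = ⇔-no (ℕₚ.<-irrefl refl) (ℕₚ.<-irrefl refl)
sorted-mono x<y y<z 0F 1F = ⇔-yes z<s x<y
sorted-mono x<y y<z 0F 2F = ⇔-yes z<s (ℕₚ.<-trans x<y y<z)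
sorted-mono x<y y<z 1F 0F = ⇔-no (λ ()) (ℕₚ.<-asym x<y)
sorted-mono x<y y<z 1F 1F = ⇔-no (ℕₚ.<-irrefl refl) (ℕₚ.<-irrefl refl)
sorted-mono x<y y<z 1F 2F = ⇔-yes (s<s z<s) y<z
sorted-mono x<y y<z 2F 0F = ⇔-no (λ ()) (ℕₚ.<-asym (ℕₚ.<-trans x<y y<z))
sorted-mono x<y y<z 2F 1F = ⇔-no (λ { (s<s ()) }) (ℕₚ.<-asym y<z)
sorted-mono x<y y<z 2F 2F = ⇔-no (ℕₚ.<-irrefl refl) (ℕₚ.<-irrefl refl)

-- The three letters are given in increasing order and `lookup q` picks among them, so one
-- comparison table serves 123, 132 and 213.
sorted-occurrence : ∀ {n} (q : Word 3 3) (σ : Word n n) {ι} {x y z : Fin n} → x Fin.< y → y Fin.< z →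
  Linked Fin._<_ ι → (∀ j → lookup σ (lookup ι j) ≡ lookup (x ∷ y ∷ z ∷ []) (lookup q j)) →
  IsOccurrence q σ ι
sorted-occurrence q σ x<y y<z ι↑ eq = ι↑ , λ j l →
  subst₂ (λ u v → lookup q j Fin.< lookup q l ⇔ u Fin.< v) (sym (eq j)) (sym (eq l))
    (sorted-mono x<y y<z (lookup q j) (lookup q l))

≢fromℕ⇒< : ∀ {n} {i : Fin (suc n)} → i ≢ fromℕ n → i Fin.< fromℕ n
≢fromℕ⇒< {n} {i} i≢⊤ with view i
... | ‵fromℕ     = contradiction refl i≢⊤
... | ‵inject₁ j = subst (toℕ (inject₁ j) ℕ.<_) (sym (Finₚ.toℕ-fromℕ n)) (Finₚ.inject₁ℕ< j)

module _ {n} {a : Fin (suc n)} {b : Fin (suc (suc n))} {w : Word (suc (suc n)) n}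
  (avoider : Avoider (inject₁ a ∷ b ∷ w)) where

  open Avoider avoider

  private
    τ : Word (suc (suc n)) (suc (suc n))
    τ = inject₁ a ∷ b ∷ w

    a<⊤ : inject₁ a Fin.< fromℕ (suc n)
    a<⊤ = ≢fromℕ⇒< (Finₚ.fromℕ≢inject₁ ∘ sym)

  -- By surjectivity the largest value sits somewhere, and not in front. In third place or later it
  -- would complete the first two letters to 123 or 213, according to their order.
  second-top : b ≡ fromℕ (suc n)
  second-top with injective⇒surjective injective (fromℕ (suc n))
  ... | zero , a≡⊤        = contradiction (sym a≡⊤) Finₚ.fromℕ≢inject₁
  ... | suc zero , b≡⊤    = b≡⊤
  ... | suc (suc j) , c≡⊤ = contradiction occurrence no-occurrence
    where
    ι : Word (suc (suc n)) 3
    ι = 0F ∷ 1F ∷ suc (suc j) ∷ []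
    b<⊤ : b Fin.< fromℕ (suc n)
    b<⊤ = ≢fromℕ⇒< λ b≡⊤ → contradiction (injective {1F} {suc (suc j)} (trans b≡⊤ (sym c≡⊤))) λ ()
    ι↑ : Linked Fin._<_ ι
    ι↑ = z<s ∷ s<s z<s ∷ [-]
    no-occurrence : ¬ (IsOccurrence p123 τ ι ⊎ IsOccurrence p213 τ ι)
    no-occurrence = [ ¬occurrence p123 τ avoids-123 ι , ¬occurrence p213 τ avoids-213 ι ]
    occurrence : IsOccurrence p123 τ ι ⊎ IsOccurrence p213 τ ι
    occurrence with Finₚ.<-cmp (inject₁ a) b
    ... | tri< a<b _ _ = inj₁ (sorted-occurrence p123 τ a<b b<⊤ ι↑
            λ { 0F → refl ; 1F → refl ; 2F → c≡⊤ })
    ... | tri≈ _ a≡b _ = contradiction (injective {0F} {1F} a≡b) λ ()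
    ... | tri> _ _ b<a = inj₂ (sorted-occurrence p213 τ b<a a<⊤ ι↑
            λ { 0F → refl ; 1F → refl ; 2F → c≡⊤ })

  -- Otherwise the second largest value comes after the largest one, and the first letter, the
  -- largest and the second largest form 132.
  first-below-top : a ≡ fromℕ n
  first-below-top with a Finₚ.≟ fromℕ n | injective⇒surjective injective (inject₁ (fromℕ n))
  ... | yes a≡s | _ = a≡s
  ... | no a≢s  | zero , a≡s = Finₚ.inject₁-injective a≡s
  ... | no a≢s  | suc zero , b≡s = contradiction (trans (sym second-top) b≡s) Finₚ.fromℕ≢inject₁
  ... | no a≢s  | suc (suc j) , c≡s = contradiction
    (sorted-occurrence p132 τ
      (subst₂ ℕ._<_ (sym (Finₚ.toℕ-inject₁ a)) (sym (Finₚ.toℕ-inject₁ (fromℕ n))) (≢fromℕ⇒< a≢s))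
      (≢fromℕ⇒< (Finₚ.fromℕ≢inject₁ ∘ sym))
      (z<s ∷ s<s z<s ∷ [-]) λ { 0F → refl ; 1F → second-top ; 2F → c≡s })
    (¬occurrence p132 τ avoids-132 (0F ∷ 1F ∷ suc (suc j) ∷ []))

-- Only the form is recorded; that `σ` is again an avoider comes from `avoider-prefix₁` and
-- `avoider-prefix₂`.
data Shape : ∀ {n} → Word n n → Set where
  empty : Shape []
  via-prefix₁ : ∀ {n} (σ : Word n n) → Shape (prefix₁ σ)
  via-prefix₂ : ∀ {n} (σ : Word n n) → Shape (prefix₂ σ)

shape : ∀ {n} {τ : Word n n} → Avoider τ → Shape τ
shape {τ = []} _ = empty
shape {τ = a ∷ w} avoider with view a
... | ‵fromℕ
  with uninject₁ w (λ i wᵢ≡⊤ → contradiction (Avoider.injective avoider {suc i} {0F} wᵢ≡⊤) λ ())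
...   | σ , refl = via-prefix₁ σ
shape {τ = _ ∷ b ∷ w} avoider | ‵inject₁ a
  with refl ← second-top avoider | refl ← first-below-top avoider
  -- By injectivity the remaining letters miss both top values, so `inject₁` can be stripped from
  -- them twice.
  with w′ , refl ← uninject₁ w (λ i wᵢ≡⊤ →
         contradiction (Avoider.injective avoider {suc (suc i)} {1F} wᵢ≡⊤) λ ())
  with σ , refl ← uninject₁ w′ (λ i wᵢ≡s →
         contradiction (Avoider.injective avoider {suc (suc i)} {0F}
           (trans (Vecₚ.lookup-map i inject₁ w′) (cong inject₁ wᵢ≡s))) λ ())
  = via-prefix₂ σ

prefix₁∈layered : ∀ {n} {σ : Word n n} → σ ∈ layered n → prefix₁ σ ∈ layered (suc n)
prefix₁∈layered {zero}  σ∈ = ∈ₚ.∈-map⁺ prefix₁ σ∈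
prefix₁∈layered {suc n} σ∈ = ∈ₚ.∈-++⁺ˡ (∈ₚ.∈-map⁺ prefix₁ σ∈)

avoider⇒layered : ∀ n {τ : Word n n} → Avoider τ → τ ∈ layered n
avoider⇒layered n avoider with shape avoider
avoider⇒layered zero          avoider | empty    = here refl
avoider⇒layered (suc n)       avoider | via-prefix₁ σ =
  prefix₁∈layered (avoider⇒layered n (from (avoider-prefix₁ σ) avoider))
avoider⇒layered (suc (suc n)) avoider | via-prefix₂ σ =
  ∈ₚ.∈-++⁺ʳ (List.map prefix₁ (layered (suc n)))
    (∈ₚ.∈-map⁺ prefix₂ (avoider⇒layered n (from (avoider-prefix₂ σ) avoider)))

avoider-[] : Avoider []
avoider-[] = record { injective = λ { {()} } ; avoids-123 = refl ; avoids-132 = refl ; avoids-213 = refl }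

layered-avoider : ∀ n → Listᴬ.All Avoider (layered n)
layered-avoider 0             = avoider-[] Listᴬ.∷ Listᴬ.[]
layered-avoider 1             = to (avoider-prefix₁ []) avoider-[] Listᴬ.∷ Listᴬ.[]
layered-avoider (suc (suc n)) = Listᴬₚ.++⁺
  (Listᴬₚ.map⁺ (Listᴬ.map (λ {σ} → to (avoider-prefix₁ σ)) (layered-avoider (suc n))))
  (Listᴬₚ.map⁺ (Listᴬ.map (λ {σ} → to (avoider-prefix₂ σ)) (layered-avoider n)))

-- A rearrangement is enough, since the list is only summed over.
S↭layered : ∀ n → S[123,132,213] n ↭ layered n
S↭layered n = unique∧⇔⇒↭
  (Uniqueₚ.filter⁺ _ (Uniqueₚ.filter⁺ isPermutation? (words-unique n n)))
  (layered-unique n)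
  (mk⇔ to′ from′)
  where
  avoids-all? = λ (σ : Word n n) → avoids? p123 σ ×-dec avoids? p132 σ ×-dec avoids? p213 σ
  to′ : ∀ {σ} → σ ∈ S[123,132,213] n → σ ∈ layered n
  to′ {σ} σ∈ = avoider⇒layered n (record
    { injective  = proj₁ (proj₂ (∈ₚ.∈-filter⁻ isPermutation? {xs = words n n} (proj₁ split)))
    ; avoids-123 = trans (sym (occurrences≡occ p123 σ)) (proj₁ (proj₂ split))
    ; avoids-132 = trans (sym (occurrences≡occ p132 σ)) (proj₁ (proj₂ (proj₂ split)))
    ; avoids-213 = trans (sym (occurrences≡occ p213 σ)) (proj₂ (proj₂ (proj₂ split)))
    })
    where
    split : σ ∈ permutations n × Avoids p123 σ × Avoids p132 σ × Avoids p213 σ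
    split = ∈ₚ.∈-filter⁻ avoids-all? {xs = permutations n} σ∈
  from′ : ∀ {σ} → σ ∈ layered n → σ ∈ S[123,132,213] n
  from′ {σ} σ∈ = ∈ₚ.∈-filter⁺ avoids-all?
    (∈ₚ.∈-filter⁺ isPermutation? (words-complete _)
      (injective , strictlySurjective⇒surjective (injective⇒surjective injective)))
    ( trans (occurrences≡occ p123 σ) avoids-123
    , trans (occurrences≡occ p132 σ) avoids-132
    , trans (occurrences≡occ p213 σ) avoids-213
    )
    where open Avoider (Listᴬ.lookup (layered-avoider n) σ∈)

f≡total : ∀ {k} (q : Word k k) n → f q n ≡ total (Vec.map toℕ q) n
f≡total q n = trans (sum-↭ (↭ₚ.map⁺ (occurrences q) (S↭layered n)))
  (cong sum (Listₚ.map-cong (occurrences≡occ q) (layered n)))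

-- Generating functions

total-[]-gf : gf (total []) * D ^ 1 ≈ 1#
total-[]-gf n = trans (*-cong {gf (total [])} {gf (total [])} {D ^ 1} {D} (λ _ → refl) (R.*-identityʳ D) n)
  -- The subwords of length zero do not depend on the word, so a prefix leaves `occ-word []`
  -- unchanged by computation.
  (gf-fibonacci (total []) (trans (ℕₚ.+-identityʳ _) (occ-[] [])) refl (total-suc² []) n)

module _ {k} (d : ℕ) {p : Vec ℕ k} {P : Series} (p-gf : gf (total p) * D ^ d ≈ P) where

  total-max-gf : ∀ {a} → All (ℕ._< a) p → gf (total (a ∷ p)) * D ^ suc d ≈ Y * P
  total-max-gf {a} p<a = chain d {gf (total (a ∷ p))} {gf (total p)} {Y} {P}
    (gf-max (total (a ∷ p)) (total p) refl (total-max-1 p<a) (total-max p<a)) p-gf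

  total-ascent-gf : ∀ {a b} → a ℕ.< b → All (ℕ._< a) p →
    gf (total (a ∷ b ∷ p)) * D ^ suc d ≈ X ^ 2 * P
  total-ascent-gf {a} {b} a<b p<a = chain d {gf (total (a ∷ b ∷ p))} {gf (total p)} {X ^ 2} {P}
    (gf-ascent (total (a ∷ b ∷ p)) (total p) refl (total-ascent-1 a<b p<a) (total-ascent a<b p<a)) p-gf

total-231-gf : gf (total (1 ∷ 2 ∷ 0 ∷ [])) * D ^ 3 ≈ X ^ 2 * (Y * 1#)
total-231-gf = total-ascent-gf 2 {P = Y * 1#}
  (total-max-gf 1 {P = 1#} total-[]-gf []) (s<s z<s) (z<s ∷ [])

total-312-gf : gf (total (2 ∷ 0 ∷ 1 ∷ [])) * D ^ 3 ≈ Y * (X ^ 2 * 1#)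
total-312-gf = total-max-gf 2 {P = X ^ 2 * 1#}
  (total-ascent-gf 1 {P = 1#} total-[]-gf z<s []) (z<s ∷ s<s z<s ∷ [])

total-321-gf : gf (total (2 ∷ 1 ∷ 0 ∷ [])) * D ^ 4 ≈ Y * (Y * (Y * 1#))
total-321-gf = total-max-gf 3 {P = Y * (Y * 1#)}
  (total-max-gf 2 {P = Y * 1#} (total-max-gf 1 {P = 1#} total-[]-gf []) (z<s ∷ []))
  (s<s z<s ∷ z<s ∷ [])

-- Cutting off below degree 3 loses nothing: words of length 0, 1 and 2 have no subwords of length
-- three, and both sides compute to `0ℤ`.
gf≥3-f : ∀ (q : Word 3 3) → gf≥ 3 (f q) ≈ gf (total (Vec.map toℕ q))
gf≥3-f (_ ∷ _ ∷ _ ∷ [])   0                   = refl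
gf≥3-f (_ ∷ _ ∷ _ ∷ [])   1                   = refl
gf≥3-f (_ ∷ _ ∷ _ ∷ [])   2                   = refl
gf≥3-f q                  (suc (suc (suc n))) = cong ℤ.+_ (f≡total q (suc (suc (suc n))))

gf≥3-f-quotient : ∀ (q : Word 3 3) {P P′ Q} (Q₀≡1 : Q 0 ≡ 1ℤ) →
  gf (total (Vec.map toℕ q)) * Q ≈ P → P ≈ P′ → gf≥ 3 (f q) ≈ P′ / Q ⟨ Q₀≡1 ⟩
gf≥3-f-quotient q {P} {P′} {Q} Q₀≡1 solves P≈P′ n = trans (gf≥3-f q n)
  (quotient-unique (gf (total (Vec.map toℕ q))) P′ Q Q₀≡1 (λ m → trans (solves m) (P≈P′ m)) n)

theorem3p4 : (gf≥ 3 (f p231) ≈ gf≥ 3 (f p312)) ×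
    (gf≥ 3 (f p312) ≈ X ^ 3 * (1# + 2 · X) / (1# - X - X ^ 2) ^ 3 ⟨ refl ⟩) ×
    (gf≥ 3 (f p321) ≈ X ^ 3 * (1# + 6 · X + 12 · X ^ 2 + 8 · X ^ 3) / (1# - X - X ^ 2) ^ 4 ⟨ refl ⟩)
theorem3p4 = (λ n → trans (231-quotient n) (sym (312-quotient n))) , 312-quotient , 321-quotient
  where
  231-quotient : gf≥ 3 (f p231) ≈ X ^ 3 * (1# + 2 · X) / D ^ 3 ⟨ refl ⟩
  231-quotient = gf≥3-f-quotient p231 {X ^ 2 * (Y * 1#)} {X ^ 3 * (1# + 2 · X)} {D ^ 3}
    refl total-231-gf X²Y
  312-quotient : gf≥ 3 (f p312) ≈ X ^ 3 * (1# + 2 · X) / D ^ 3 ⟨ refl ⟩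
  312-quotient = gf≥3-f-quotient p312 {Y * (X ^ 2 * 1#)} {X ^ 3 * (1# + 2 · X)} {D ^ 3}
    refl total-312-gf YX²
  321-quotient : gf≥ 3 (f p321) ≈ X ^ 3 * (1# + 6 · X + 12 · X ^ 2 + 8 · X ^ 3) / D ^ 4 ⟨ refl ⟩
  321-quotient = gf≥3-f-quotient p321 {Y * (Y * (Y * 1#))}
    {X ^ 3 * (1# + 6 · X + 12 · X ^ 2 + 8 · X ^ 3)} {D ^ 4}
    refl total-321-gf Y³
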